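{- Let $G$ be a connected simple graph of order $n\geq 3$, and let $\overline{G}$ denote its complement. Then $\lambda_3(G)=n-3$ if and only if $\overline{G}$ is one of the following: (i) $\overline{G}=rP_2\cup (n-2r)K_1$ for some integer $r$ with $2\leq r\leq \lfloor n/2\rfloor$; (ii) $\overline{G}=P_4\cup sP_2\cup (n-2s-4)K_1$ for some integer $s$ with $0\leq s\leq \lfloor (n-4)/2\rfloor$; (iii) $\overline{G}=P_3\cup tP_2\cup (n-2t-3)K_1$ for some integer $t$ with $0\leq t\leq \lfloor (n-3)/2\rfloor$; (iv) $\overline{G}=C_3\cup tP_2\cup (n-2t-3)K_1$ for some integer $t$ with $0\leq t\leq \lfloor (n-3)/2\rfloor$.
   Context: All graphs are finite, undirected and simple. $P_m$ is the path on $m$ vertices, $C_3$ the triangle, $K_1$ a single vertex; $mH$ is the disjoint union of $m$ copies of $H$ and $\cup$ denotes disjoint union. For $S\subseteq V(G)$ with $|S|\geq 2$, an $S$-tree is a subgraph of $G$ that is a tree containing all vertices of $S$; $\lambda(S)$ is the maximum number of pairwise edge-disjoint $S$-trees in $G$. For $2\leq k\leq n$, $\lambda_k(G)=\min\{\lambda(S): S\subseteq V(G),\ |S|=k\}$, and $\lambda_k(G)=0$ if $G$ is disconnected. -}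

module Defs where

open import Data.Nat using (ℕ; zero; suc; _+_; _*_; _≡ᵇ_; _≤_)
open import Data.Bool using (Bool; true; false; not; _∧_; _∨_; if_then_else_)
open import Data.Fin using (Fin; toℕ; splitAt; _≟_)
open import Data.Fin.Subset using (Subset; _∈_; ∣_∣)
open import Data.Sum using (_⊎_; inj₁; inj₂)
open import Data.List using (List; []; _∷_; _++_; [_]; length)
open import Data.List.Relation.Unary.Unique.Propositional using (Unique)
open import Data.Product using (Σ; _×_; ∃; ∃-syntax)
open import Data.Unit using (⊤)
open import Relation.Nullary using (¬_; yes; no)
open import Relation.Binary.PropositionalEquality using (_≡_; _≢_)
open import Function.Bundles using (_↔_; Inverse)

Graph : ℕ → Set
Graph n = Fin n → Fin n → Bool

IsSimple : ∀ {n} → Graph n → Set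
IsSimple {n} G = (∀ (u v : Fin n) → G u v ≡ G v u) × (∀ (u : Fin n) → G u u ≡ false)

complement : ∀ {n} → Graph n → Graph n
complement G u v with u ≟ v
... | yes _ = false
... | no _ = not (G u v)

data Reach {n} (E : Graph n) : Fin n → Fin n → Set where
  here : ∀ {u} → Reach E u u
  step : ∀ {u w v} → E u w ≡ true → Reach E w v → Reach E u v

Connected : ∀ {n} → Graph n → Set
Connected {n} G = ∀ (u v : Fin n) → Reach G u v

record Subgraph (n : ℕ) : Set where
  field
    verts : Fin n → Bool
    edges : Graph n
open Subgraph public

Chain : ∀ {n} → Graph n → List (Fin n) → Set
Chain E [] = ⊤
Chain E (x ∷ []) = ⊤
Chain E (x ∷ y ∷ r) = (E x y ≡ true) × Chain E (y ∷ r)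

HasCycle : ∀ {n} → Graph n → Set
HasCycle {n} E = Σ (Fin n) λ x → Σ (List (Fin n)) λ xs →
  (2 ≤ length xs) × Unique (x ∷ xs) × Chain E (x ∷ xs ++ [ x ])

IsSubtree : ∀ {n} → Graph n → Subgraph n → Set
IsSubtree {n} G T =
  (∀ (u v : Fin n) → edges T u v ≡ true → G u v ≡ true)
  × (∀ (u v : Fin n) → edges T u v ≡ edges T v u)
  × (∀ (u v : Fin n) → edges T u v ≡ true → verts T u ≡ true)
  × (∀ (u v : Fin n) → verts T u ≡ true → verts T v ≡ true → Reach (edges T) u v)
  × ¬ HasCycle (edges T)

IsSTree : ∀ {n} → Graph n → Subset n → Subgraph n → Set
IsSTree {n} G S T = IsSubtree G T × (∀ (v : Fin n) → v ∈ S → verts T v ≡ true)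

EdgeDisjoint : ∀ {n k} → (Fin k → Subgraph n) → Set
EdgeDisjoint {n} {k} T = ∀ (i j : Fin k) → i ≢ j →
  ∀ (u v : Fin n) → edges (T i) u v ≡ true → edges (T j) u v ≡ false

HasTrees : ∀ {n} → Graph n → Subset n → ℕ → Set
HasTrees {n} G S k = Σ (Fin k → Subgraph n) λ T →
  (∀ i → IsSTree G S (T i)) × EdgeDisjoint T

-- λ(S) = m : m is the maximum number of edge-disjoint S-trees
LambdaS : ∀ {n} → Graph n → Subset n → ℕ → Set
LambdaS G S m = HasTrees G S m × ¬ HasTrees G S (suc m)

-- λ_k(G) = m : minimum of λ(S) over |S| = k, or 0 if G is disconnected
LambdaK : ∀ {n} → Graph n → ℕ → ℕ → Set
LambdaK {n} G k m =
  (Connected G →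
     (∀ (S : Subset n) → ∣ S ∣ ≡ k → ∃[ m' ] (LambdaS G S m' × m ≤ m'))
     × (∃[ S ] (∣ S ∣ ≡ k × LambdaS G S m)))
  × (¬ Connected G → m ≡ 0)

_≅_ : ∀ {n m} → Graph n → Graph m → Set
_≅_ {n} {m} G H = Σ (Fin n ↔ Fin m) λ f →
  ∀ (u v : Fin n) → G u v ≡ H (Inverse.to f u) (Inverse.to f v)

_∪_ : ∀ {a b} → Graph a → Graph b → Graph (a + b)
_∪_ {a} {b} G H u v with splitAt a u | splitAt a v
... | inj₁ x | inj₁ y = G x y
... | inj₂ x | inj₂ y = H x y
... | inj₁ _ | inj₂ _ = false
... | inj₂ _ | inj₁ _ = false

copies : ∀ {k} → (m : ℕ) → Graph k → Graph (m * k)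
copies zero H ()
copies (suc m) H = H ∪ copies m H

P : (m : ℕ) → Graph m
P m u v = (suc (toℕ u) ≡ᵇ toℕ v) ∨ (suc (toℕ v) ≡ᵇ toℕ u)

C₃ : Graph 3
C₃ u v with u ≟ v
... | yes _ = false
... | no _ = true

K₁ : Graph 1
K₁ _ _ = false

{-# OPTIONS --safe #-}

-- Write H for the complement of G. The theorem factors through a local description of H:
-- no vertex has three neighbours, any two vertices of degree two are adjacent, and there are
-- at least two edges. Such graphs are exactly the ones listed.
--
-- Upper bounds: edge-disjoint S-trees use distinct edges at every u ∈ S, so there are at most
-- deg u of them. If there are exactly deg u = deg v trees for adjacent u, v ∈ S, then both
-- u and v are leaves of the tree containing uv, which therefore misses the rest of S.
--
-- Lower bounds: for S = {a, b, c} every v outside S carries the star from v to S. When v is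
-- not joined in G to some s ∈ S, the star is repaired by an edge inside S or, if these do not
-- suffice, by a path s - x - v through a fixed outside vertex x whose own tree is then
-- replaced by the path a - c - b.
module Submission where

open import Defs
open import Data.Bool using (true; false)
import Data.Bool as Bool
open import Data.Bool.Properties using (∨-comm; ¬-not)
open import Data.Empty using (⊥; ⊥-elim)
open import Data.Fin using (Fin; zero; suc; _≟_; inject≤; _↑ˡ_; _↑ʳ_; splitAt)
open import Data.Fin.Permutation using (↔⇒≡)
open import Data.Fin.Properties using (injective⇒≤; suc-injective; inject≤-injective; any?; all?; splitAt-↑ˡ; splitAt-↑ʳ; splitAt⁻¹-↑ˡ; splitAt⁻¹-↑ʳ; ↑ˡ-injective; ↑ʳ-injective)
open import Data.Fin.Subset using (Subset; ∣_∣; inside; outside; ⁅_⁆) renaming (_∈_ to _∈ₛ_; _∪_ to _∪ₛ_)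
open import Data.Fin.Subset.Properties using (x∈⁅x⁆; x∈⁅y⁆⇒x≡y; x∈p∪q⁺; x∈p∪q⁻) renaming (_∈?_ to _∈ₛ?_)
open import Data.List using (List; []; _∷_; _++_; [_]; length; map; lookup; filter; allFin)
open import Data.List.Membership.Propositional using (_∈_; _∉_)
open import Data.List.Membership.Propositional.Properties using (∈-allFin; ∈-filter⁺; ∈-filter⁻; ∈-map⁺; ∈-map⁻; ∈-++⁺ˡ; ∈-++⁺ʳ; ∈-++⁻; ∈-lookup)
import Data.List.Membership.DecPropositional as DecMembership
open import Data.List.Properties using (length-map; length-++; length-tabulate; length-filter)
open import Data.List.Relation.Unary.All as All using (All; []; _∷_)
open import Data.List.Relation.Unary.All.Properties using (All¬⇒¬Any; ¬Any⇒All¬)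
open import Data.List.Relation.Unary.AllPairs using ([]; _∷_)
open import Data.List.Relation.Unary.Any as Any using (here; there)
open import Data.List.Relation.Unary.Any.Properties using (lookup-index)
open import Data.List.Relation.Unary.Unique.Propositional using (Unique)
import Data.List.Relation.Unary.Unique.Propositional.Properties as Unique
open import Data.Maybe using (Maybe; just; nothing)
open import Data.Maybe.Properties using (just-injective)
open import Data.Nat using (ℕ; zero; suc; _≤_; _<_; _∸_; _*_; _+_; _/_; z≤n; s≤s)
open import Data.Nat.DivMod using (m*n/n≡m; /-monoˡ-≤)
open import Data.Nat.Properties using (≤-refl; ≤-trans; ≤-antisym; <-trans; <-irrefl; ≤⇒≯; n≤1+n; m≤m+n; m+n∸m≡n; +-comm; +-cancelˡ-≤; *-comm; *-identityʳ; ∸-+-assoc)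
open import Data.Product using (∃-syntax; _×_; _,_; proj₁; proj₂; uncurry)
open import Data.Product.Properties using (≡-dec)
open import Data.Sum using (_⊎_; inj₁; inj₂; [_,_]′)
open import Data.Vec using ([]; _∷_; here; there)
open import Function using (_∘_; id; case_of_)
open import Function.Bundles using (_⇔_; mk⇔; Inverse; mk↔ₛ′)
open import Relation.Binary.PropositionalEquality using (_≡_; _≢_; refl; sym; trans; cong; cong₂; subst; ≢-sym; module ≡-Reasoning)
open import Relation.Nullary using (¬_; Dec; yes; no; does; contradiction)
open import Relation.Nullary.Decidable using (¬?; _×-dec_; _⊎-dec_; _→-dec_; dec-true; dec-false; from-yes; map′)

-- One tree per outside vertex gives n - 3 trees. A vertex with d neighbours in H has n - 1 - d
-- edges in G, so n - 3 trees at every S force d ≤ 2, and two vertices with d = 2 that are joined in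
-- G are the tight pair of the upper bound. The condition on the number of edges comes from the
-- other half of the minimum: n - 1 trees never exist, and n - 2 trees fail for some S exactly when
-- H has at least two edges. Since `LambdaK` demands the exact maximum at every S, each S has to be
-- decided between n - 3 and n - 2.
--
-- The obstacle below is a count of broken spokes, that is, edges from S to outside vertices that G
-- lacks. Edges inside S repair at most three of them. If a misses x and y outside S, then b and c
-- may miss one vertex each, which makes four. If H contains x - a - b with x outside S, there may
-- be three, but G has only two edges inside S. In both cases one tree spends ac and bc, so that the
-- spokes at x become available to the others; sparsity of H guarantees that the edges of these
-- detours exist.

private
  variable
    V : Set
    n m : ℕ

-- Counting with duplicate-free lists

lookup-injective : {xs : List V} → Unique xs → ∀ i j → lookup xs i ≡ lookup xs j → i ≡ j
lookup-injective (_  ∷ _)  zero    zero    _  = refl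
lookup-injective (p  ∷ _)  zero    (suc j) eq = contradiction eq (All.lookup p (∈-lookup j))
lookup-injective (p  ∷ _)  (suc i) zero    eq = contradiction (sym eq) (All.lookup p (∈-lookup i))
lookup-injective (_  ∷ us) (suc i) (suc j) eq = cong suc (lookup-injective us i j eq)

unique-⊆⇒length≤ : {xs ys : List V} → Unique xs → (∀ {x} → x ∈ xs → x ∈ ys) → length xs ≤ length ys
unique-⊆⇒length≤ {xs = xs} {ys} u sub =
  injective⇒≤ {f = λ i → Any.index (sub (∈-lookup i))} λ {i} {j} eq →
    lookup-injective u i j
      (trans (lookup-index (sub (∈-lookup i)))
        (trans (cong (lookup ys) eq) (sym (lookup-index (sub (∈-lookup j))))))

unique⇒length≤ : {xs : List (Fin n)} → Unique xs → length xs ≤ n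
unique⇒length≤ {n} {xs} u =
  subst (length xs ≤_) (length-tabulate {n = n} id) (unique-⊆⇒length≤ u (λ {x} _ → ∈-allFin x))

module _ {n : ℕ} where
  open DecMembership (_≟_ {n}) public using (_∈?_)
  open DecMembership (≡-dec (_≟_ {n}) (_≟_ {n})) public using () renaming (_∈?_ to _∈ₑ?_)

outsideOf : List (Fin n) → List (Fin n)
outsideOf {n} xs = filter (λ v → ¬? (v ∈? xs)) (allFin n)

length-outsideOf : (xs : List (Fin n)) → n ≤ length xs + length (outsideOf xs)
length-outsideOf {n} xs =
  subst (_≤ length xs + length (outsideOf xs)) (length-tabulate {n = n} id)
    (subst (length (allFin n) ≤_) (length-++ xs)
      (unique-⊆⇒length≤ (Unique.allFin⁺ n) covers))
  where
  covers : ∀ {v} → v ∈ allFin n → v ∈ xs ++ outsideOf xs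
  covers {v} v∈ with v ∈? xs
  ... | yes p = ∈-++⁺ˡ p
  ... | no ¬p = ∈-++⁺ʳ xs (∈-filter⁺ (λ v → ¬? (v ∈? xs)) v∈ ¬p)

-- Three-element subsets

-- The elements are named in an order. `rotate` and `flip₂₃` reach every other order, so a case
-- analysis can assume that the special vertex comes first.
record Triple (S : Subset n) (a b c : Fin n) : Set where
  constructor triple
  field
    a≢b : a ≢ b
    a≢c : a ≢ c
    b≢c : b ≢ c
    covers : ∀ {v} → v ∈ₛ S → v ∈ a ∷ b ∷ c ∷ []
    a∈ : a ∈ₛ S
    b∈ : b ∈ₛ S
    c∈ : c ∈ₛ S

  distinct : Unique (a ∷ b ∷ c ∷ [])
  distinct = (a≢b ∷ a≢c ∷ []) ∷ (b≢c ∷ []) ∷ [] ∷ []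

rotate : {S : Subset n} {a b c : Fin n} → Triple S a b c → Triple S b c a
rotate (triple ab ac bc cov a∈ b∈ c∈) =
  triple bc (≢-sym ab) (≢-sym ac) (rot ∘ cov) b∈ c∈ a∈
  where
  rot : ∀ {v a b c : Fin _} → v ∈ a ∷ b ∷ c ∷ [] → v ∈ b ∷ c ∷ a ∷ []
  rot (here p)                 = there (there (here p))
  rot (there (here p))         = here p
  rot (there (there (here p))) = there (here p)

flip₂₃ : {S : Subset n} {a b c : Fin n} → Triple S a b c → Triple S a c b
flip₂₃ (triple ab ac bc cov a∈ b∈ c∈) =
  triple ac ab (≢-sym bc) (flp ∘ cov) a∈ c∈ b∈
  where
  flp : ∀ {v a b c : Fin _} → v ∈ a ∷ b ∷ c ∷ [] → v ∈ a ∷ c ∷ b ∷ []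
  flp (here p)                 = here p
  flp (there (here p))         = there (there (here p))
  flp (there (there (here p))) = there (here p)

elements : Subset n → List (Fin n)
elements []            = []
elements (inside  ∷ S) = zero ∷ map suc (elements S)
elements (outside ∷ S) = map suc (elements S)

length-elements : (S : Subset n) → length (elements S) ≡ ∣ S ∣
length-elements []            = refl
length-elements (inside  ∷ S) = cong suc (trans (length-map suc (elements S)) (length-elements S))
length-elements (outside ∷ S) = trans (length-map suc (elements S)) (length-elements S)

elements-unique : (S : Subset n) → Unique (elements S)
elements-unique []            = []
elements-unique (inside  ∷ S) =
  ¬Any⇒All¬ _ (λ p → case ∈-map⁻ suc p of λ ()) ∷ Unique.map⁺ suc-injective (elements-unique S)
elements-unique (outside ∷ S) = Unique.map⁺ suc-injective (elements-unique S)

∈-elements⁺ : (S : Subset n) {v : Fin n} → v ∈ₛ S → v ∈ elements S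
∈-elements⁺ (inside  ∷ S) here      = here refl
∈-elements⁺ (inside  ∷ S) (there p) = there (∈-map⁺ suc (∈-elements⁺ S p))
∈-elements⁺ (outside ∷ S) (there p) = ∈-map⁺ suc (∈-elements⁺ S p)

∈-elements⁻ : (S : Subset n) {v : Fin n} → v ∈ elements S → v ∈ₛ S
∈-elements⁻ (inside ∷ S) (here refl) = here
∈-elements⁻ (inside ∷ S) (there p) with ∈-map⁻ suc p
... | _ , q , refl = there (∈-elements⁻ S q)
∈-elements⁻ (outside ∷ S) p with ∈-map⁻ suc p
... | _ , q , refl = there (∈-elements⁻ S q)

toTriple : (S : Subset n) → ∣ S ∣ ≡ 3 → ∃[ a ] ∃[ b ] ∃[ c ] Triple S a b c
toTriple S eq with elements S | length-elements S | elements-unique S | ∈-elements⁺ S | ∈-elements⁻ S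
... | a ∷ b ∷ c ∷ [] | _ | (ab ∷ ac ∷ []) ∷ (bc ∷ []) ∷ _ | to | from =
  a , b , c , triple ab ac bc to (from (here refl)) (from (there (here refl))) (from (there (there (here refl))))
... | []                | l | _ | _ | _ = contradiction (trans l eq) λ ()
... | _ ∷ []            | l | _ | _ | _ = contradiction (trans l eq) λ ()
... | _ ∷ _ ∷ []        | l | _ | _ | _ = contradiction (trans l eq) λ ()
... | _ ∷ _ ∷ _ ∷ _ ∷ _ | l | _ | _ | _ = contradiction (trans l eq) λ ()

fromDistinct : {a b c : Fin n} → a ≢ b → a ≢ c → b ≢ c → ∃[ S ] (∣ S ∣ ≡ 3 × Triple S a b c)
fromDistinct {n} {a} {b} {c} ab ac bc = S , card , tr
  where
  S = ⁅ a ⁆ ∪ₛ (⁅ b ⁆ ∪ₛ ⁅ c ⁆)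

  to : ∀ {v} → v ∈ₛ S → v ∈ a ∷ b ∷ c ∷ []
  to p with x∈p∪q⁻ ⁅ a ⁆ _ p
  ... | inj₁ q = here (x∈⁅y⁆⇒x≡y a q)
  ... | inj₂ q with x∈p∪q⁻ ⁅ b ⁆ _ q
  ... | inj₁ r = there (here (x∈⁅y⁆⇒x≡y b r))
  ... | inj₂ r = there (there (here (x∈⁅y⁆⇒x≡y c r)))

  a∈ = x∈p∪q⁺ (inj₁ (x∈⁅x⁆ a))
  b∈ = x∈p∪q⁺ {p = ⁅ a ⁆} (inj₂ (x∈p∪q⁺ (inj₁ (x∈⁅x⁆ b))))
  c∈ = x∈p∪q⁺ {p = ⁅ a ⁆} (inj₂ (x∈p∪q⁺ {p = ⁅ b ⁆} (inj₂ (x∈⁅x⁆ c))))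

  from : ∀ {v} → v ∈ a ∷ b ∷ c ∷ [] → v ∈ₛ S
  from (here refl)                 = a∈
  from (there (here refl))         = b∈
  from (there (there (here refl))) = c∈

  tr : Triple S a b c
  tr = triple ab ac bc to a∈ b∈ c∈

  card : ∣ S ∣ ≡ 3
  card = trans (sym (length-elements S)) (≤-antisym
    (unique-⊆⇒length≤ (elements-unique S) (to ∘ ∈-elements⁻ S))
    (unique-⊆⇒length≤ (Triple.distinct tr) (∈-elements⁺ S ∘ from)))

-- Trees grown leaf by leaf

pattern 0th = here refl
pattern 1st = there (here refl)
pattern 2nd = there (there (here refl))
pattern 3rd = there (there (there (here refl)))

Arcs : ℕ → Set
Arcs n = List (Fin n × Fin n)

Joins : Arcs n → Fin n → Fin n → Set
Joins es u v = (u , v) ∈ es ⊎ (v , u) ∈ es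

joins? : (es : Arcs n) (u v : Fin n) → Dec (Joins es u v)
joins? es u v = ((u , v) ∈ₑ? es) ⊎-dec ((v , u) ∈ₑ? es)

does⇒ : {Q : Set} (d : Dec Q) → does d ≡ true → Q
does⇒ (yes q) _ = q

subgraph : List (Fin n) → Arcs n → Subgraph n
subgraph vs es = record
  { verts = λ v → does (v ∈? vs)
  ; edges = λ u v → does (joins? es u v)
  }

-- Arcs point from child to parent and every child is fresh. Uniqueness of parents, connectedness
-- and acyclicity thus follow by induction on the construction; `subgraph` forgets the directions.
data Grown {n} (G : Graph n) : List (Fin n) → Arcs n → Set where
  root : ∀ r → Grown G [ r ] []
  leaf : ∀ {vs es c p} → G c p ≡ true → p ∈ vs → All (c ≢_) vs →
         Grown G vs es → Grown G (c ∷ vs) ((c , p) ∷ es)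

module _ {G : Graph n} where

  tail∈ : ∀ {vs es c p} → Grown G vs es → (c , p) ∈ es → c ∈ vs
  tail∈ (leaf _ _ _ g) (here refl) = here refl
  tail∈ (leaf _ _ _ g) (there e)   = there (tail∈ g e)

  head∈ : ∀ {vs es c p} → Grown G vs es → (c , p) ∈ es → p ∈ vs
  head∈ (leaf _ p∈ _ g) (here refl) = there p∈
  head∈ (leaf _ _  _ g) (there e)   = there (head∈ g e)

  arc-in-G : ∀ {vs es c p} → Grown G vs es → (c , p) ∈ es → G c p ≡ true
  arc-in-G (leaf e _ _ g) (here refl) = e
  arc-in-G (leaf _ _ _ g) (there e)   = arc-in-G g e

  parent-unique : ∀ {vs es c p q} → Grown G vs es → (c , p) ∈ es → (c , q) ∈ es → p ≡ q
  parent-unique (leaf _ _ _ g) (here refl) (here refl) = refl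
  parent-unique (leaf _ _ f g) (here refl) (there e)   = contradiction (tail∈ g e) (All¬⇒¬Any f)
  parent-unique (leaf _ _ f g) (there e)   (here refl) = contradiction (tail∈ g e) (All¬⇒¬Any f)
  parent-unique (leaf _ _ _ g) (there d)   (there e)   = parent-unique g d e

  -- The rank that `Acyclic` asks for. Since a new leaf is fresh, hanging it leaves all earlier
  -- depths unchanged.
  depth : ∀ {vs es} → Grown G vs es → Fin n → ℕ
  depth (root _) _ = 0
  depth (leaf {c = c} {p} _ _ _ g) v with v ≟ c
  ... | yes _ = suc (depth g p)
  ... | no  _ = depth g v

  depth-old : ∀ {vs es c p} (e : G c p ≡ true) (p∈ : p ∈ vs) (f : All (c ≢_) vs) (g : Grown G vs es) {v : Fin n} →
              v ∈ vs → depth (leaf e p∈ f g) v ≡ depth g v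
  depth-old {c = c} _ _ f g {v} v∈ with v ≟ c
  ... | yes refl = contradiction v∈ (All¬⇒¬Any f)
  ... | no  _    = refl

  depth-new : ∀ {vs es c p} (e : G c p ≡ true) (p∈ : p ∈ vs) (f : All (c ≢_) vs) (g : Grown G vs es) →
              depth (leaf e p∈ f g) c ≡ suc (depth g p)
  depth-new {c = c} _ _ _ _ with c ≟ c
  ... | yes _  = refl
  ... | no c≢c = contradiction refl c≢c

  parent-depth : ∀ {vs es c p} (g : Grown G vs es) → (c , p) ∈ es → depth g p < depth g c
  parent-depth (leaf e p∈ f g) (here refl)
    rewrite depth-new e p∈ f g | depth-old e p∈ f g p∈ = ≤-refl
  parent-depth (leaf e p∈ f g) (there d)
    rewrite depth-old e p∈ f g (tail∈ g d) | depth-old e p∈ f g (head∈ g d) = parent-depth g d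

-- In a rooted forest a walk that never backtracks cannot ascend after it has descended.
-- A cycle would therefore ascend throughout, descend throughout, or leave and re-enter its
-- base point through the same parent.
module Acyclic {n} (E : Graph n) (Parent : Fin n → Fin n → Set) (ρ : Fin n → ℕ)
  (unique : ∀ {c p q} → Parent c p → Parent c q → p ≡ q)
  (lower : ∀ {c p} → Parent c p → ρ p < ρ c)
  (orient : ∀ {u v} → E u v ≡ true → Parent u v ⊎ Parent v u) where

  module _ (x : Fin n) where

    -- The walk has come to v from its parent u. Going up again would mean returning to u, so it
    -- keeps descending and finally enters x from the parent of x.
    descend : ∀ u v ys → Parent v u → x ≢ u → All (x ≢_) (v ∷ ys) → All (u ≢_) ys → Unique (v ∷ ys) →
              Chain E (v ∷ ys ++ [ x ]) → ∃[ l ] (l ∈ v ∷ ys × Parent x l × ρ u < ρ x)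
    descend u v [] vu x≢u _ _ _ (vx , _) with orient vx
    ... | inj₁ v→x = contradiction (unique v→x vu) x≢u
    ... | inj₂ x→v = v , here refl , x→v , <-trans (lower vu) (lower x→v)
    descend u v (w ∷ ys) vu x≢u (x≢v ∷ xys) (u≢w ∷ _) ((v≢w ∷ vys) ∷ us) (vw , ch) with orient vw
    ... | inj₁ v→w = contradiction (unique vu v→w) u≢w
    ... | inj₂ w→v with descend v w ys w→v x≢v xys vys us ch
    ... | l , l∈ , x→l , lt = l , there l∈ , x→l , <-trans (lower vu) lt

    -- A climbing walk either turns downwards once, and `descend` then brings it into x from the
    -- parent of x, or climbs all the way, which places x below u.
    ascend : ∀ u v ys → Parent u v → All (x ≢_) (v ∷ ys) → Unique (v ∷ ys) →
             Chain E (v ∷ ys ++ [ x ]) → ∃[ l ] (l ∈ v ∷ ys × Parent x l) ⊎ ρ x < ρ u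
    ascend u v [] uv _ _ (vx , _) with orient vx
    ... | inj₁ v→x = inj₂ (<-trans (lower v→x) (lower uv))
    ... | inj₂ x→v = inj₁ (v , here refl , x→v)
    ascend u v (w ∷ ys) uv (x≢v ∷ xys) ((_ ∷ vys) ∷ us) (vw , ch) with orient vw
    ... | inj₂ w→v with descend v w ys w→v x≢v xys vys us ch
    ... | l , l∈ , x→l , _ = inj₁ (l , there l∈ , x→l)
    ascend u v (w ∷ ys) uv (x≢v ∷ xys) (_ ∷ us) (vw , ch) | inj₁ v→w with ascend v w ys v→w xys us ch
    ... | inj₁ (l , l∈ , x→l) = inj₁ (l , there l∈ , x→l)
    ... | inj₂ lt             = inj₂ (<-trans lt (lower uv))

  acyclic : ¬ HasCycle E
  acyclic (x , [] , () , _)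
  acyclic (x , _ ∷ [] , s≤s () , _)
  acyclic (x , y ∷ z ∷ ys , _ , (x≢y ∷ xs) ∷ (y≢zs@(y≢z ∷ yys)) ∷ us , (xy , yz , ch)) with orient xy | orient yz
  ... | inj₂ y→x | inj₁ y→z = All.head xs (unique y→x y→z)
  ... | inj₂ y→x | inj₂ z→y with descend x y z ys z→y x≢y xs yys us ch
  ... | _ , _ , _ , lt = <-irrefl refl (<-trans (lower y→x) lt)
  acyclic (x , y ∷ z ∷ ys , _ , (x≢y ∷ xs) ∷ (y≢zs@(y≢z ∷ yys)) ∷ us , (xy , yz , ch)) | inj₁ x→y | inj₂ z→y
    with descend x y z ys z→y x≢y xs yys us ch
  ... | l , l∈ , x→l , _ = All.lookup y≢zs l∈ (unique x→y x→l)
  acyclic (x , y ∷ z ∷ ys , _ , (x≢y ∷ xs) ∷ (y≢zs@(y≢z ∷ yys)) ∷ us , (xy , yz , ch)) | inj₁ x→y | inj₁ y→z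
    with ascend x y z ys y→z xs us ch
  ... | inj₁ (l , l∈ , x→l) = All.lookup y≢zs l∈ (unique x→y x→l)
  ... | inj₂ lt = <-irrefl refl (<-trans lt (lower x→y))

reach-trans : {E : Graph n} {u v w : Fin n} → Reach E u v → Reach E v w → Reach E u w
reach-trans here       q = q
reach-trans (step e p) q = step e (reach-trans p q)

reach-mono : {E F : Graph n} → (∀ {u v} → E u v ≡ true → F u v ≡ true) →
             ∀ {u v} → Reach E u v → Reach F u v
reach-mono f here       = here
reach-mono f (step e p) = step (f e) (reach-mono f p)

module _ {G : Graph n} where

  grown-reach : ∀ {vs es u v} → Grown G vs es → u ∈ vs → v ∈ vs → Reach (edges (subgraph vs es)) u v
  grown-reach (root r) (here refl) (here refl) = here
  grown-reach {vs = c ∷ vs} {es = (c , p) ∷ es} (leaf _ p∈ _ g) = go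
    where
    F = edges (subgraph (c ∷ vs) ((c , p) ∷ es))

    lift : ∀ {u v} → Reach (edges (subgraph vs es)) u v → Reach F u v
    lift = reach-mono λ {u} {v} e → dec-true (joins? ((c , p) ∷ es) u v)
      ([ inj₁ ∘ there , inj₂ ∘ there ]′ (does⇒ (joins? es u v) e))

    go : ∀ {u v} → u ∈ c ∷ vs → v ∈ c ∷ vs → Reach F u v
    go (here refl) (here refl) = here
    go (here refl) (there v∈)  =
      step (dec-true (joins? ((c , p) ∷ es) c p) (inj₁ (here refl))) (lift (grown-reach g p∈ v∈))
    go (there u∈)  (here refl) =
      reach-trans (lift (grown-reach g u∈ p∈)) (step (dec-true (joins? ((c , p) ∷ es) p c) (inj₂ (here refl))) here)
    go (there u∈)  (there v∈)  = lift (grown-reach g u∈ v∈)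

  grown-subtree : (∀ u v → G u v ≡ G v u) → ∀ {vs es} → Grown G vs es → IsSubtree G (subgraph vs es)
  grown-subtree G-sym {vs} {es} g =
      (λ u v e → [ arc-in-G g , trans (G-sym u v) ∘ arc-in-G g ]′ (joined e))
    , (λ u v → ∨-comm (does ((u , v) ∈ₑ? es)) (does ((v , u) ∈ₑ? es)))
    , (λ u v e → dec-true (u ∈? vs) ([ tail∈ g , head∈ g ]′ (joined e)))
    , (λ u v p q → grown-reach g (does⇒ (u ∈? vs) p) (does⇒ (v ∈? vs) q))
    , Acyclic.acyclic _ (λ c p → (c , p) ∈ es) (depth g) (parent-unique g) (parent-depth g) joined
    where
    joined : ∀ {u v} → does (joins? es u v) ≡ true → Joins es u v
    joined {u} {v} = does⇒ (joins? es u v)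

-- Packings

-- The tree with index just v is built around the vertex v; nothing is the index of one extra tree.
-- Edge-disjointness holds because every arc determines the index of its tree.

module Packing {n} (G : Graph n) (G-sym : ∀ u v → G u v ≡ G v u)
  (core : List (Fin n)) (core-unique : Unique core)
  (Inner : Maybe (Fin n) → Fin (length core) → Fin (length core) → Set)
  (inner-same : ∀ {s t i j} → Inner s i j → Inner t i j → s ≡ t)
  (inner-opposite : ∀ {s t i j} → Inner s i j → Inner t j i → s ≡ t)
  where

  -- Arcs run from child to parent: a spoke hangs a core vertex from an outside vertex, which is
  -- itself the index of the tree. Arcs inside the core are given by positions, so that clashes
  -- between them are refuted by matching on numerals.
  data Owns (t : Maybe (Fin n)) : Fin n × Fin n → Set where
    spoke : ∀ {p q} → t ≡ just q → q ∉ core → p ∈ core → Owns t (p , q)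
    inner : ∀ i j → Inner t i j → Owns t (lookup core i , lookup core j)

  private
    OwnsAt : Maybe (Fin n) → Fin n → Fin n → Set
    OwnsAt t p q = (t ≡ just q × q ∉ core × p ∈ core)
                 ⊎ ∃[ i ] ∃[ j ] (Inner t i j × p ≡ lookup core i × q ≡ lookup core j)

    view : ∀ {t p q} → Owns t (p , q) → OwnsAt t p q
    view (spoke e f g) = inj₁ (e , f , g)
    view (inner i j h) = inj₂ (i , j , h , refl , refl)

    core∈ : ∀ {p} i → p ≡ lookup core i → p ∈ core
    core∈ i refl = ∈-lookup i

    same-index : ∀ {p} i j → p ≡ lookup core i → p ≡ lookup core j → i ≡ j
    same-index i j e f = lookup-injective core-unique i j (trans (sym e) f)

    owner-same : ∀ {s t p q} → OwnsAt s p q → OwnsAt t p q → s ≡ t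
    owner-same (inj₁ (refl , _)) (inj₁ (refl , _)) = refl
    owner-same (inj₁ (_ , q∉ , _)) (inj₂ (_ , j , _ , _ , f)) = contradiction (core∈ j f) q∉
    owner-same (inj₂ (_ , j , _ , _ , f)) (inj₁ (_ , q∉ , _)) = contradiction (core∈ j f) q∉
    owner-same (inj₂ (i , j , h , e , f)) (inj₂ (i′ , j′ , h′ , e′ , f′))
      with refl ← same-index i i′ e e′ | refl ← same-index j j′ f f′ = inner-same h h′

    owner-opposite : ∀ {s t p q} → OwnsAt s p q → OwnsAt t q p → s ≡ t
    owner-opposite (inj₁ (_ , q∉ , _)) (inj₁ (_ , _ , q∈)) = contradiction q∈ q∉
    owner-opposite (inj₁ (_ , q∉ , _)) (inj₂ (i , _ , _ , e , _)) = contradiction (core∈ i e) q∉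
    owner-opposite (inj₂ (i , _ , _ , e , _)) (inj₁ (_ , p∉ , _)) = contradiction (core∈ i e) p∉
    owner-opposite (inj₂ (i , j , h , e , f)) (inj₂ (j′ , i′ , h′ , f′ , e′))
      with refl ← same-index i i′ e e′ | refl ← same-index j j′ f f′ = inner-opposite h h′

  record TreeAt (a b c : Fin n) (t : Maybe (Fin n)) : Set where
    constructor tree
    field
      {vs} : List (Fin n)
      {es} : Arcs n
      grown : Grown G vs es
      a∈ : a ∈ vs
      b∈ : b ∈ vs
      c∈ : c ∈ vs
      owned : All (Owns t) es

  -- An inequality between k and the number of indices suffices, because surplus trees are dropped
  -- through `inject≤`.
  pack : ∀ {S a b c k} → Triple S a b c → (ts : List (Maybe (Fin n))) → Unique ts → k ≤ length ts →
         (∀ {t} → t ∈ ts → TreeAt a b c t) → HasTrees G S k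
  pack {S} {a} {b} {c} {k} tr ts ts-unique k≤ at = T , isTree , disjoint
    where
    at′ : ∀ i → TreeAt a b c (lookup ts (inject≤ i k≤))
    at′ i = at (∈-lookup (inject≤ i k≤))

    open TreeAt

    T : Fin k → Subgraph n
    T i = subgraph (vs (at′ i)) (es (at′ i))

    isTree : ∀ i → IsSTree G S (T i)
    isTree i = grown-subtree G-sym (grown (at′ i)) , λ v v∈ → dec-true (v ∈? _) (spans (Triple.covers tr v∈))
      where
      spans : ∀ {v} → v ∈ a ∷ b ∷ c ∷ [] → v ∈ vs (at′ i)
      spans (here refl)                 = a∈ (at′ i)
      spans (there (here refl))         = b∈ (at′ i)
      spans (there (there (here refl))) = c∈ (at′ i)

    disjoint : EdgeDisjoint T
    disjoint i j i≢j u v e = dec-false (joins? (es (at′ j)) u v) λ e′ →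
      i≢j (inject≤-injective k≤ k≤ i j (lookup-injective ts-unique _ _ (owner (does⇒ (joins? (es (at′ i)) u v) e) e′)))
      where
      own : ∀ i {p q} → (p , q) ∈ es (at′ i) → OwnsAt _ p q
      own i = view ∘ All.lookup (owned (at′ i))

      owner : Joins (es (at′ i)) u v → Joins (es (at′ j)) u v →
              lookup ts (inject≤ i k≤) ≡ lookup ts (inject≤ j k≤)
      owner (inj₁ p) (inj₁ q) = owner-same     (own i p) (own j q)
      owner (inj₁ p) (inj₂ q) = owner-opposite (own i p) (own j q)
      owner (inj₂ p) (inj₁ q) = owner-opposite (own i p) (own j q)
      owner (inj₂ p) (inj₂ q) = owner-same     (own i p) (own j q)

  -- The vertex list is an index here, unlike in `TreeAt`: during the construction, membership and
  -- freshness can then be given by literal positions.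
  record Partial (t : Maybe (Fin n)) (vs : List (Fin n)) : Set where
    constructor partial
    field
      {es} : Arcs n
      grown : Grown G vs es
      owned : All (Owns t) es

  seed : ∀ {t} r → Partial t [ r ]
  seed r = partial (root r) []

  ParentOf : Maybe (Fin n) → List (Fin n) → Fin n → Set
  ParentOf t vs c = ∃[ p ] (p ∈ vs × G c p ≡ true × Owns t (c , p))

  attach : ∀ {t c vs} → ParentOf t vs c → All (c ≢_) vs → Partial t vs → Partial t (c ∷ vs)
  attach (p , p∈ , e , o) fresh (partial g os) = partial (leaf e p∈ fresh g) (o ∷ os)

  complete : ∀ {t vs a b c} → Partial t vs → a ∈ vs → b ∈ vs → c ∈ vs → TreeAt a b c t
  complete (partial g os) a∈ b∈ c∈ = tree g a∈ b∈ c∈ os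

  module _ {S : Subset n} {a b c : Fin n} {k : ℕ} (tr : Triple S a b c) (3+k≤n : 3 + k ≤ n) where

    private
      outer : List (Maybe (Fin n))
      outer = map just (outsideOf (a ∷ b ∷ c ∷ []))

      outer-unique : Unique outer
      outer-unique = Unique.map⁺ just-injective (Unique.filter⁺ _ (Unique.allFin⁺ n))

      k≤outer : k ≤ length outer
      k≤outer = subst (k ≤_) (sym (length-map just (outsideOf (a ∷ b ∷ c ∷ []))))
        (+-cancelˡ-≤ 3 k _ (≤-trans 3+k≤n (length-outsideOf (a ∷ b ∷ c ∷ []))))

      trees-at : (∀ {v} → ¬ v ∈ₛ S → TreeAt a b c (just v)) → ∀ {t} → t ∈ outer → TreeAt a b c t
      trees-at at t∈ with ∈-map⁻ just t∈
      ... | v , v∈ , refl =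
        at (proj₂ (∈-filter⁻ (λ v → ¬? (v ∈? a ∷ b ∷ c ∷ [])) {xs = allFin n} v∈) ∘ Triple.covers tr)

    packOuter : (∀ {v} → ¬ v ∈ₛ S → TreeAt a b c (just v)) → HasTrees G S k
    packOuter at = pack tr outer outer-unique k≤outer (trees-at at)

    packOuter⁺ : TreeAt a b c nothing → (∀ {v} → ¬ v ∈ₛ S → TreeAt a b c (just v)) → HasTrees G S (suc k)
    packOuter⁺ at₀ at = pack tr (nothing ∷ outer)
      (¬Any⇒All¬ _ (λ p → case ∈-map⁻ just p of λ ()) ∷ outer-unique) (s≤s k≤outer)
      λ { (here refl) → at₀ ; (there t∈) → trees-at at t∈ }

-- Upper bounds on packings

module Upper {n} {G : Graph n} (S : Subset n) {k : ℕ} (trees : HasTrees G S k) where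

  private
    T = proj₁ trees
    isTree = proj₁ (proj₂ trees)
    disjoint = proj₂ (proj₂ trees)

    edge-in-G : ∀ i {u v} → edges (T i) u v ≡ true → G u v ≡ true
    edge-in-G i = proj₁ (proj₁ (isTree i)) _ _

    same-tree : ∀ {i j u v} → edges (T i) u v ≡ true → edges (T j) u v ≡ true → i ≡ j
    same-tree {i} {j} e f with i ≟ j
    ... | yes p = p
    ... | no ¬p = contradiction (trans (sym f) (disjoint i j ¬p _ _ e)) λ ()

    reach : ∀ i {u w} → u ∈ₛ S → w ∈ₛ S → Reach (edges (T i)) u w
    reach i u∈ w∈ = proj₁ (proj₂ (proj₂ (proj₂ (proj₁ (isTree i))))) _ _ (proj₂ (isTree i) _ u∈) (proj₂ (isTree i) _ w∈)

    first-step : ∀ {E : Graph n} {u w} → u ≢ w → Reach E u w → ∃[ v ] E u v ≡ true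
    first-step u≢u here       = contradiction refl u≢u
    first-step _   (step e _) = _ , e

  -- Each tree contains u and w and therefore an edge at u; f picks the other end of one.
  -- Disjointness makes f injective, and its values avoid `M`, a list of known non-neighbours of u
  -- that may include u itself. No degree has to be computed.
  module At {u w} (u∈ : u ∈ₛ S) (w∈ : w ∈ₛ S) (u≢w : u ≢ w)
    {M : List (Fin n)} (M-unique : Unique M) (M-missing : All (λ v → G u v ≡ false) M) where

    private
      f : Fin k → Fin n
      f i = proj₁ (first-step u≢w (reach i u∈ w∈))

      f-edge : ∀ i → edges (T i) u (f i) ≡ true
      f-edge i = proj₂ (first-step u≢w (reach i u∈ w∈))

      f-injective : ∀ {i j} → f i ≡ f j → i ≡ j
      f-injective {i} {j} eq = same-tree (f-edge i) (subst (λ v → edges (T j) u v ≡ true) (sym eq) (f-edge j))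

      used : List (Fin n)
      used = M ++ map f (allFin k)

      used-unique : Unique used
      used-unique = Unique.++⁺ M-unique (Unique.map⁺ f-injective (Unique.allFin⁺ k)) clash
        where
        clash : ∀ {v} → ¬ (v ∈ M × v ∈ map f (allFin k))
        clash (v∈M , v∈f) with ∈-map⁻ f v∈f
        ... | i , _ , refl = contradiction (trans (sym (edge-in-G i (f-edge i))) (All.lookup M-missing v∈M)) λ ()

      length-used : length used ≡ length M + k
      length-used = trans (length-++ M) (cong (length M +_) (trans (length-map f (allFin k)) (length-tabulate {n = k} id)))

    degree-bound : length M + k ≤ n
    degree-bound = subst (_≤ n) length-used (unique⇒length≤ used-unique)

    -- If the degree bound is tight, every edge at u is the only edge at u of some tree.
    module Tight (tight : n ≤ length M + k) where

      private
        -- A neighbour of u that no tree picks could be added to `used`, which already has n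
        -- entries.
        is-f : ∀ {v} → G u v ≡ true → ∃[ i ] f i ≡ v
        is-f {v} uv with any? (λ i → f i ≟ v)
        ... | yes p = p
        ... | no ∄ = contradiction (unique⇒length≤ (fresh ∷ used-unique))
                       (≤⇒≯ (subst (n ≤_) (sym length-used) tight))
          where
          fresh : All (v ≢_) used
          fresh = ¬Any⇒All¬ used λ v∈ → case ∈-++⁻ M v∈ of λ where
            (inj₁ v∈M) → contradiction (trans (sym uv) (All.lookup M-missing v∈M)) λ ()
            (inj₂ v∈f) → case ∈-map⁻ f v∈f of λ (i , _ , eq) → ∄ (i , sym eq)

        only-f : ∀ {i v} → edges (T i) u v ≡ true → v ≡ f i
        only-f {i} uv with is-f (edge-in-G i uv)
        ... | j , refl = cong f (same-tree (f-edge j) uv)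

      owner : ∀ {v} → G u v ≡ true → ∃[ i ] edges (T i) u v ≡ true
      owner uv with is-f uv
      ... | i , refl = i , f-edge i

      sole : ∀ {i v z} → edges (T i) u v ≡ true → edges (T i) u z ≡ true → z ≡ v
      sole uv uz = trans (only-f uz) (sym (only-f uv))

  -- The tree through the edge uv would consist of that edge alone.
  tight-pair : ∀ {u v w} → u ∈ₛ S → v ∈ₛ S → w ∈ₛ S → u ≢ v → u ≢ w → v ≢ w →
    ∀ {M N} → Unique M → All (λ z → G u z ≡ false) M → n ≤ length M + k →
    Unique N → All (λ z → G v z ≡ false) N → n ≤ length N + k →
    G u v ≡ true → ⊥
  tight-pair {u} {v} {w} u∈ v∈ w∈ u≢v u≢w v≢w M! M× M-tight N! N× N-tight uv with U.owner uv
    where module U = At.Tight u∈ v∈ u≢v M! M× M-tight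
  ... | i , e = stuck (inj₁ refl) (reach i u∈ w∈)
    where
    module U = At.Tight u∈ v∈ u≢v M! M× M-tight
    module V = At.Tight v∈ u∈ (≢-sym u≢v) N! N× N-tight

    e′ : edges (T i) v u ≡ true
    e′ = trans (proj₁ (proj₂ (proj₁ (isTree i))) v u) e

    stuck : ∀ {z} → z ≡ u ⊎ z ≡ v → Reach (edges (T i)) z w → ⊥
    stuck (inj₁ refl) here       = u≢w refl
    stuck (inj₂ refl) here       = v≢w refl
    stuck (inj₁ refl) (step d r) = stuck (inj₂ (U.sole e d)) r
    stuck (inj₂ refl) (step d r) = stuck (inj₁ (V.sole e′ d)) r

-- Sparse graphs

Branch : Graph n → Fin n → Set
Branch H u = ∃[ x ] ∃[ y ] (x ≢ y × H u x ≡ true × H u y ≡ true)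

record Sparse (H : Graph n) : Set where
  field
    degree≤2 : ∀ {u x y z} → H u x ≡ true → H u y ≡ true → H u z ≡ true → x ≢ y → x ≢ z → y ≢ z → ⊥
    branches-adjacent : ∀ {u v} → u ≢ v → Branch H u → Branch H v → H u v ≡ true

-- Distinctness of the edges is witnessed by an end w of the second that is off the first. In a
-- simple graph distinct edges always have such an end; z may still be u or v.
TwoEdges : Graph n → Set
TwoEdges H = ∃[ u ] ∃[ v ] ∃[ w ] ∃[ z ] (H u v ≡ true × H w z ≡ true × w ≢ u × w ≢ v)

-- Working with any H that satisfies this specification keeps complement from unfolding.
record IsComplement (G H : Graph n) : Set where
  field
    ~⇒≢       : ∀ {u v} → H u v ≡ true → u ≢ v
    ~⇒missing : ∀ {u v} → H u v ≡ true → G u v ≡ false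
    joined    : ∀ {u v} → u ≢ v → H u v ≢ true → G u v ≡ true
    ~-sym     : ∀ {u v} → H u v ≡ true → H v u ≡ true

complement-isComplement : {G : Graph n} → IsSimple G → IsComplement G (complement G)
complement-isComplement {G = G} (G-sym , _) = record
  { ~⇒≢       = λ {u} {v} → ~⇒≢ u v
  ; ~⇒missing = λ {u} {v} → ~⇒missing u v
  ; joined    = λ {u} {v} → joined u v
  ; ~-sym     = λ {u} {v} → ~-sym u v
  }
  where
  ~⇒≢ : ∀ u v → complement G u v ≡ true → u ≢ v
  ~⇒≢ u v e u≡v with u ≟ v
  ~⇒≢ u v () _   | yes _
  ~⇒≢ u v _  u≡v | no u≢v = u≢v u≡v

  ~⇒missing : ∀ u v → complement G u v ≡ true → G u v ≡ false
  ~⇒missing u v e with u ≟ v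
  ~⇒missing u v () | yes _
  ~⇒missing u v e  | no _ with G u v
  ~⇒missing u v e  | no _ | false = refl
  ~⇒missing u v () | no _ | true

  joined : ∀ u v → u ≢ v → complement G u v ≢ true → G u v ≡ true
  joined u v u≢v ¬e with u ≟ v
  ... | yes u≡v = contradiction u≡v u≢v
  ... | no _ with G u v
  ... | true  = refl
  ... | false = contradiction refl ¬e

  ~-sym : ∀ u v → complement G u v ≡ true → complement G v u ≡ true
  ~-sym u v e with complement G v u Bool.≟ true
  ... | yes p = p
  ... | no ¬p = contradiction
    (trans (sym (~⇒missing u v e)) (trans (G-sym u v) (joined v u (≢-sym (~⇒≢ u v e)) ¬p))) λ ()

module Adjacency {n} (H : Graph n) where

  infix 4 _~_ _~?_

  _~_ : Fin n → Fin n → Set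
  u ~ v = H u v ≡ true

  _~?_ : ∀ u v → Dec (u ~ v)
  u ~? v = H u v Bool.≟ true

  branch? : ∀ u → Dec (Branch H u)
  branch? u = any? λ x → any? λ y → ¬? (x ≟ y) ×-dec (u ~? x) ×-dec (u ~? y)

  unbranched : ∀ {u x y} → ¬ Branch H u → u ~ x → u ~ y → x ≡ y
  unbranched {u} {x} {y} ¬b ux uy with x ≟ y
  ... | yes p = p
  ... | no ¬p = contradiction (x , y , ¬p , ux , uy) ¬b

-- Positions in the core a, b, c, x of a packing; later also the vertices of the small concrete
-- graphs.
pattern A = zero
pattern B = suc zero
pattern C = suc (suc zero)
pattern X = suc (suc (suc zero))

-- Star packings and their repairs

module Lower {k} {G H : Graph (3 + k)} (simple : IsSimple G) (isComplement : IsComplement G H)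
  {S : Subset (3 + k)} where

  open Adjacency H
  open IsComplement isComplement

  private
    G-sym = proj₁ simple

  Outer : Fin (3 + k) → Set
  Outer v = ¬ v ∈ₛ S

  outer⇒∉ : ∀ {a b c v} → Triple S a b c → Outer v → v ∉ a ∷ b ∷ c ∷ []
  outer⇒∉ tr o (here refl)                 = o (Triple.a∈ tr)
  outer⇒∉ tr o (there (here refl))         = o (Triple.b∈ tr)
  outer⇒∉ tr o (there (there (here refl))) = o (Triple.c∈ tr)

  module _ {a b c : Fin (3 + k)} (tr : Triple S a b c) where

    open Triple tr

    private
      ∉-abc : ∀ {v} → Outer v → v ∉ a ∷ b ∷ c ∷ []
      ∉-abc = outer⇒∉ tr

      a≢ : ∀ {v} → Outer v → a ≢ v
      a≢ o refl = o a∈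

      b≢ : ∀ {v} → Outer v → b ≢ v
      b≢ o refl = o b∈

      c≢ : ∀ {v} → Outer v → c ≢ v
      c≢ o refl = o c∈

    -- All spokes at b and c exist, so only a can need repair: the edge ab serves the star at x and
    -- ac the star at y.
    module OneDeficient (x y : Fin (3 + k))
      (b-full : ∀ {v} → Outer v → ¬ b ~ v)
      (c-full : ∀ {v} → Outer v → ¬ c ~ v)
      (repair : ∀ {v} → Outer v → a ~ v → (v ≡ x × G a b ≡ true) ⊎ (v ≡ y × G a c ≡ true)) where

      private
        data Inner : Maybe (Fin (3 + k)) → Fin 3 → Fin 3 → Set where
          ab : Inner (just x) A B
          ac : Inner (just y) A C

        same : ∀ {s t i j} → Inner s i j → Inner t i j → s ≡ t
        same ab ab = refl
        same ac ac = refl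

        opposite : ∀ {s t i j} → Inner s i j → Inner t j i → s ≡ t
        opposite ab ()
        opposite ac ()

        open Packing G G-sym (a ∷ b ∷ c ∷ []) distinct Inner same opposite

        at : ∀ {v} → Outer v → TreeAt a b c (just v)
        at {v} o =
          complete
            (attach a-parent (a≢b ∷ a≢c ∷ a≢ o ∷ [])
            (attach (v , 1st , joined (b≢ o) (b-full o) , spoke refl (∉-abc o) 1st) (b≢c ∷ b≢ o ∷ [])
            (attach (v , 0th , joined (c≢ o) (c-full o) , spoke refl (∉-abc o) 2nd) (c≢ o ∷ [])
            (seed v))))
            0th 1st 2nd
          where
          a-parent : ParentOf (just v) (b ∷ c ∷ v ∷ []) a
          a-parent with a ~? v
          ... | no ¬av = v , 2nd , joined (a≢ o) ¬av , spoke refl (∉-abc o) 0th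
          ... | yes av with repair o av
          ... | inj₁ (refl , e) = b , 0th , e , inner A B ab
          ... | inj₂ (refl , e) = c , 1st , e , inner A C ac

      trees : HasTrees G S k
      trees = packOuter tr ≤-refl at

    -- The path a - b - c becomes one tree more than there are outside vertices. This leaves ac as
    -- the only edge for repairs, so a may miss only x.
    module OneDeficient⁺ (x : Fin (3 + k)) (G-ab : G a b ≡ true) (G-bc : G b c ≡ true)
      (b-full : ∀ {v} → Outer v → ¬ b ~ v)
      (c-full : ∀ {v} → Outer v → ¬ c ~ v)
      (repair : ∀ {v} → Outer v → a ~ v → v ≡ x × G a c ≡ true) where

      private
        data Inner : Maybe (Fin (3 + k)) → Fin 3 → Fin 3 → Set where
          ab : Inner nothing A B
          bc : Inner nothing B C
          ac : Inner (just x) A C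

        same : ∀ {s t i j} → Inner s i j → Inner t i j → s ≡ t
        same ab ab = refl
        same bc bc = refl
        same ac ac = refl

        opposite : ∀ {s t i j} → Inner s i j → Inner t j i → s ≡ t
        opposite ab ()
        opposite bc ()
        opposite ac ()

        open Packing G G-sym (a ∷ b ∷ c ∷ []) distinct Inner same opposite

        at₀ : TreeAt a b c nothing
        at₀ = complete
          (attach (b , 0th , G-ab , inner A B ab) (a≢b ∷ a≢c ∷ [])
          (attach (c , 0th , G-bc , inner B C bc) (b≢c ∷ [])
          (seed c)))
          0th 1st 2nd

        at : ∀ {v} → Outer v → TreeAt a b c (just v)
        at {v} o =
          complete
            (attach a-parent (a≢b ∷ a≢c ∷ a≢ o ∷ [])
            (attach (v , 1st , joined (b≢ o) (b-full o) , spoke refl (∉-abc o) 1st) (b≢c ∷ b≢ o ∷ [])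
            (attach (v , 0th , joined (c≢ o) (c-full o) , spoke refl (∉-abc o) 2nd) (c≢ o ∷ [])
            (seed v))))
            0th 1st 2nd
          where
          a-parent : ParentOf (just v) (b ∷ c ∷ v ∷ []) a
          a-parent with a ~? v
          ... | no ¬av = v , 2nd , joined (a≢ o) ¬av , spoke refl (∉-abc o) 0th
          ... | yes av with repair o av
          ... | refl , e = c , 1st , e , inner A C ac

      trees : HasTrees G S (suc k)
      trees = packOuter⁺ tr ≤-refl at₀ at

    -- A vertex s of S that is missing from the star at v hangs from its successor in a → b → c → a.
    module Cyclic
      (G-ab : G a b ≡ true) (G-bc : G b c ≡ true) (G-ca : G c a ≡ true)
      (a-once : ∀ {v w} → Outer v → Outer w → a ~ v → a ~ w → v ≡ w)
      (b-once : ∀ {v w} → Outer v → Outer w → b ~ v → b ~ w → v ≡ w)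
      (c-once : ∀ {v w} → Outer v → Outer w → c ~ v → c ~ w → v ≡ w)
      (not-all : ∀ {v} → a ~ v → b ~ v → c ~ v → ⊥) where

      private
        data Inner : Maybe (Fin (3 + k)) → Fin 3 → Fin 3 → Set where
          ab : ∀ {v} → Outer v → a ~ v → Inner (just v) A B
          bc : ∀ {v} → Outer v → b ~ v → Inner (just v) B C
          ca : ∀ {v} → Outer v → c ~ v → Inner (just v) C A

        same : ∀ {s t i j} → Inner s i j → Inner t i j → s ≡ t
        same (ab o e) (ab o′ e′) = cong just (a-once o o′ e e′)
        same (bc o e) (bc o′ e′) = cong just (b-once o o′ e e′)
        same (ca o e) (ca o′ e′) = cong just (c-once o o′ e e′)

        opposite : ∀ {s t i j} → Inner s i j → Inner t j i → s ≡ t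
        opposite (ab _ _) ()
        opposite (bc _ _) ()
        opposite (ca _ _) ()

        open Packing G G-sym (a ∷ b ∷ c ∷ []) distinct Inner same opposite

        module _ {v} (o : Outer v) where

          parent : ∀ {p q vs} → v ∈ vs → q ∈ vs → p ∈ a ∷ b ∷ c ∷ [] → p ≢ v →
                   G p q ≡ true → (p ~ v → Owns (just v) (p , q)) → ParentOf (just v) vs p
          parent {p} {q} v∈ q∈ p∈ p≢v pq own with p ~? v
          ... | yes pv = q , q∈ , pq , own pv
          ... | no ¬pv = v , v∈ , joined p≢v ¬pv , spoke refl (∉-abc o) p∈

          parent-a : ∀ {vs} → v ∈ vs → b ∈ vs → ParentOf (just v) vs a
          parent-a v∈ b∈ = parent v∈ b∈ 0th (a≢ o) G-ab (inner A B ∘ ab o)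

          parent-b : ∀ {vs} → v ∈ vs → c ∈ vs → ParentOf (just v) vs b
          parent-b v∈ c∈ = parent v∈ c∈ 1st (b≢ o) G-bc (inner B C ∘ bc o)

          parent-c : ∀ {vs} → v ∈ vs → a ∈ vs → ParentOf (just v) vs c
          parent-c v∈ a∈ = parent v∈ a∈ 2nd (c≢ o) G-ca (inner C A ∘ ca o)

          first : ∀ {p} → p ∈ a ∷ b ∷ c ∷ [] → p ≢ v → ¬ p ~ v → Partial (just v) (p ∷ v ∷ [])
          first p∈ p≢v ¬pv = attach (v , 0th , joined p≢v ¬pv , spoke refl (∉-abc o) p∈) (p≢v ∷ []) (seed v)

          at : TreeAt a b c (just v)
          -- By `not-all` some spoke at v exists. Starting from it, the other two vertices are
          -- attached against the cyclic order, so each finds its successor already in the tree.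
          at with c ~? v | b ~? v | a ~? v
          ... | no ¬cv | _ | _ = complete
            (attach (parent-a 2nd 0th) (a≢b ∷ a≢c ∷ a≢ o ∷ [])
            (attach (parent-b 1st 0th) (b≢c ∷ b≢ o ∷ []) (first 2nd (c≢ o) ¬cv)))
            0th 1st 2nd
          ... | yes _ | no ¬bv | _ = complete
            (attach (parent-c 2nd 0th) (≢-sym a≢c ∷ ≢-sym b≢c ∷ c≢ o ∷ [])
            (attach (parent-a 1st 0th) (a≢b ∷ a≢ o ∷ []) (first 1st (b≢ o) ¬bv)))
            1st 2nd 0th
          ... | yes _ | yes _ | no ¬av = complete
            (attach (parent-b 2nd 0th) (b≢c ∷ ≢-sym a≢b ∷ b≢ o ∷ [])
            (attach (parent-c 1st 0th) (≢-sym a≢c ∷ c≢ o ∷ []) (first 0th (a≢ o) ¬av)))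
            2nd 0th 1st
          ... | yes cv | yes bv | yes av = ⊥-elim (not-all av bv cv)

      trees : HasTrees G S k
      trees = packOuter tr ≤-refl at

    -- The tree of x is a - c - b, which frees the edges at x for the repairs b - x - v and c - x - v.
    module Hub (x : Fin (3 + k)) (x-outer : Outer x)
      (G-ac : G a c ≡ true) (G-bc : G b c ≡ true)
      (a-repair : ∀ {v} → Outer v → v ≢ x → a ~ v → G a b ≡ true)
      (b-repair : ∀ {v} → Outer v → v ≢ x → b ~ v → G b x ≡ true × G x v ≡ true)
      (c-repair : ∀ {v} → Outer v → v ≢ x → c ~ v → G c x ≡ true × G x v ≡ true)
      (a-once : ∀ {v w} → Outer v → v ≢ x → Outer w → w ≢ x → a ~ v → a ~ w → v ≡ w)
      (b-once : ∀ {v w} → Outer v → v ≢ x → Outer w → w ≢ x → b ~ v → b ~ w → v ≡ w)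
      (c-once : ∀ {v w} → Outer v → v ≢ x → Outer w → w ≢ x → c ~ v → c ~ w → v ≡ w) where

      private
        -- With x in the core, the edge xv counts as a spoke of v, while bx and cx are inner edges
        -- with owners of their own.
        core : List (Fin (3 + k))
        core = a ∷ b ∷ c ∷ x ∷ []

        core-unique : Unique core
        core-unique = (a≢b ∷ a≢c ∷ a≢ x-outer ∷ []) ∷ (b≢c ∷ b≢ x-outer ∷ []) ∷ (c≢ x-outer ∷ []) ∷ [] ∷ []

        data Inner : Maybe (Fin (3 + k)) → Fin 4 → Fin 4 → Set where
          ac : Inner (just x) A C
          bc : Inner (just x) B C
          ab : ∀ {v} → Outer v → v ≢ x → a ~ v → Inner (just v) A B
          bx : ∀ {v} → Outer v → v ≢ x → b ~ v → Inner (just v) B X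
          cx : ∀ {v} → Outer v → v ≢ x → c ~ v → Inner (just v) C X

        same : ∀ {s t i j} → Inner s i j → Inner t i j → s ≡ t
        same ac ac = refl
        same bc bc = refl
        same (ab o p e) (ab o′ p′ e′) = cong just (a-once o p o′ p′ e e′)
        same (bx o p e) (bx o′ p′ e′) = cong just (b-once o p o′ p′ e e′)
        same (cx o p e) (cx o′ p′ e′) = cong just (c-once o p o′ p′ e e′)

        opposite : ∀ {s t i j} → Inner s i j → Inner t j i → s ≡ t
        opposite ac ()
        opposite bc ()
        opposite (ab _ _ _) ()
        opposite (bx _ _ _) ()
        opposite (cx _ _ _) ()

        open Packing G G-sym core core-unique Inner same opposite

        at-x : TreeAt a b c (just x)
        at-x = complete
          (attach (c , 1st , G-ac , inner A C ac) (a≢b ∷ a≢c ∷ [])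
          (attach (c , 0th , G-bc , inner B C bc) (b≢c ∷ [])
          (seed c)))
          0th 1st 2nd

        module _ {v} (o : Outer v) (v≢x : v ≢ x) where

          v∉core : v ∉ core
          v∉core (there (there (there (here p)))) = v≢x p
          v∉core (here p)                         = ∉-abc o (here p)
          v∉core (there (here p))                 = ∉-abc o (there (here p))
          v∉core (there (there (here p)))         = ∉-abc o (there (there (here p)))

          to-v : ∀ {s vs} → s ∈ core → s ≢ v → ¬ s ~ v → v ∈ vs → ParentOf (just v) vs s
          to-v s∈ s≢v ¬sv v∈ = v , v∈ , joined s≢v ¬sv , spoke refl v∉core s∈

          parent-a : ∀ {vs} → v ∈ vs → b ∈ vs → ParentOf (just v) vs a
          parent-a v∈ b∈ with a ~? v
          ... | yes av = b , b∈ , a-repair o v≢x av , inner A B (ab o v≢x av)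
          ... | no ¬av = to-v 0th (a≢ o) ¬av v∈

          parent-b : ∀ {vs} → v ∈ vs → x ∈ vs → ParentOf (just v) vs b
          parent-b v∈ x∈ with b ~? v
          ... | yes bv = x , x∈ , proj₁ (b-repair o v≢x bv) , inner B X (bx o v≢x bv)
          ... | no ¬bv = to-v 1st (b≢ o) ¬bv v∈

          parent-c : ∀ {vs} → v ∈ vs → x ∈ vs → ParentOf (just v) vs c
          parent-c v∈ x∈ with c ~? v
          ... | yes cv = x , x∈ , proj₁ (c-repair o v≢x cv) , inner C X (cx o v≢x cv)
          ... | no ¬cv = to-v 2nd (c≢ o) ¬cv v∈

          through-x : G x v ≡ true → TreeAt a b c (just v)
          through-x xv = complete
            (attach (parent-a 3rd 0th) (a≢b ∷ a≢c ∷ a≢ x-outer ∷ a≢ o ∷ [])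
            (attach (parent-b 2nd 1st) (b≢c ∷ b≢ x-outer ∷ b≢ o ∷ [])
            (attach (parent-c 1st 0th) (c≢ x-outer ∷ c≢ o ∷ [])
            (attach (v , 0th , xv , spoke refl v∉core 3rd) (≢-sym v≢x ∷ [])
            (seed v)))))
            0th 1st 2nd

          -- The vertex x enters the tree only if b or c must hang from it: the edge xv of G is
          -- guaranteed by `b-repair` and `c-repair` in just those cases.
          at-other : TreeAt a b c (just v)
          at-other with b ~? v | c ~? v
          ... | yes bv | _      = through-x (proj₂ (b-repair o v≢x bv))
          ... | no _   | yes cv = through-x (proj₂ (c-repair o v≢x cv))
          ... | no ¬bv | no ¬cv = complete
            (attach (parent-a 2nd 0th) (a≢b ∷ a≢c ∷ a≢ o ∷ [])
            (attach (to-v 1st (b≢ o) ¬bv 1st) (b≢c ∷ b≢ o ∷ [])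
            (attach (to-v 2nd (c≢ o) ¬cv 0th) (c≢ o ∷ [])
            (seed v))))
            0th 1st 2nd

        at : ∀ {v} → Outer v → TreeAt a b c (just v)
        at {v} o with v ≟ x
        ... | yes refl = at-x
        ... | no v≢x   = at-other o v≢x

      trees : HasTrees G S k
      trees = packOuter tr ≤-refl at

hasTrees-mono : {G : Graph n} {S : Subset n} {k m : ℕ} → k ≤ m → HasTrees G S m → HasTrees G S k
hasTrees-mono k≤m (T , isTree , disjoint) =
  (λ i → T (inject≤ i k≤m)) , (λ i → isTree (inject≤ i k≤m)) ,
  λ i j i≢j → disjoint _ _ (i≢j ∘ inject≤-injective k≤m k≤m i j)

-- How many trees a triple admits

module Packings {k} {G H : Graph (3 + k)} (simple : IsSimple G) (isComplement : IsComplement G H) where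

  open Adjacency H
  open IsComplement isComplement

  neighbour? : ∀ u → Dec (∃[ x ] u ~ x)
  neighbour? u = any? (u ~?_)

  module _ {S : Subset (3 + k)} where

    -- Here n = 3 + k, so 2 + k trees would use up all n - 1 conceivable edges at a and at b. Either
    -- ab is missing from G and the degree bound fails, or a and b form a tight pair.
    no-2+k-trees : ∀ {a b c} → Triple S a b c → ¬ HasTrees G S (2 + k)
    no-2+k-trees {a} {b} tr h with a ~? b
    ... | yes ab = ≤⇒≯ (Upper.At.degree-bound S h a∈ b∈ a≢b {M = a ∷ b ∷ []} ((a≢b ∷ []) ∷ [] ∷ [])
                     (proj₂ simple a ∷ ~⇒missing ab ∷ [])) ≤-refl
      where open Triple tr
    ... | no ¬ab = Upper.tight-pair S h a∈ b∈ c∈ a≢b a≢c b≢c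
                     {M = a ∷ []} {N = b ∷ []} ([] ∷ []) (proj₂ simple a ∷ []) ≤-refl
                     ([] ∷ []) (proj₂ simple b ∷ []) ≤-refl (joined a≢b ¬ab)
      where open Triple tr

  module _ (S : Subset (3 + k)) where

    -- The two local obstructions to n - 2 trees: a vertex of degree at most n - 3 in G, or two
    -- vertices joined in G with degree at most n - 2 each, to which `tight-pair` applies.
    record Deficient : Set where
      constructor deficient
      field
        {a b c} : Fin (3 + k)
        tr : Triple S a b c
        cause : Branch H a ⊎ (¬ a ~ b × (∃[ x ] a ~ x) × (∃[ y ] b ~ y))

  no-1+k-trees : ∀ {S} → Deficient S → ¬ HasTrees G S (1 + k)
  no-1+k-trees {S} (deficient {a} tr (inj₁ (x , y , x≢y , ax , ay))) h =
    ≤⇒≯ (Upper.At.degree-bound S h a∈ b∈ a≢b {M = a ∷ x ∷ y ∷ []} ((~⇒≢ ax ∷ ~⇒≢ ay ∷ []) ∷ (x≢y ∷ []) ∷ [] ∷ [])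
           (proj₂ simple a ∷ ~⇒missing ax ∷ ~⇒missing ay ∷ [])) ≤-refl
    where open Triple tr
  no-1+k-trees {S} (deficient {a} {b} tr (inj₂ (¬ab , (x , ax) , (y , by)))) h =
    Upper.tight-pair S h a∈ b∈ c∈ a≢b a≢c b≢c
      {M = a ∷ x ∷ []} {N = b ∷ y ∷ []}
      ((~⇒≢ ax ∷ []) ∷ [] ∷ []) (proj₂ simple a ∷ ~⇒missing ax ∷ []) ≤-refl
      ((~⇒≢ by ∷ []) ∷ [] ∷ []) (proj₂ simple b ∷ ~⇒missing by ∷ []) ≤-refl (joined a≢b ¬ab)
    where open Triple tr

  deficient⇒twoEdges : ∀ {S} → Deficient S → TwoEdges H
  deficient⇒twoEdges (deficient {a} tr (inj₁ (x , y , x≢y , ax , ay))) =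
    a , x , y , a , ax , ~-sym ay , ≢-sym (~⇒≢ ay) , ≢-sym x≢y
  deficient⇒twoEdges (deficient {a} {b} tr (inj₂ (¬ab , (x , ax) , (y , by)))) =
    a , x , b , y , ax , by , ≢-sym (Triple.a≢b tr) , λ { refl → ¬ab ax }

  -- Take S = {u, v, w}. If u and w are adjacent in H, then u is a branch; otherwise they are joined
  -- in G and each misses a vertex.
  twoEdges⇒deficient : TwoEdges H → ∃[ S ] (∣ S ∣ ≡ 3 × Deficient S)
  twoEdges⇒deficient (u , v , w , z , uv , wz , w≢u , w≢v) with fromDistinct (~⇒≢ uv) (≢-sym w≢u) (≢-sym w≢v)
  ... | S , card , tr with u ~? w
  ... | yes uw = S , card , deficient tr (inj₁ (v , w , ≢-sym w≢v , uv , uw))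
  ... | no ¬uw = S , card , deficient (flip₂₃ tr) (inj₂ (¬uw , (v , uv) , (z , wz)))

  module _ {S : Subset (3 + k)} where

    private
      Alternative : Set
      Alternative = Deficient S ⊎ HasTrees G S (1 + k)

      -- The edge ab is the only edge of H that meets S, so every outside star is whole and the
      -- extra tree is the path a - c - b. No star needs a repair; `a` merely fills the place of x.
      matched-pair : ∀ {a b c} → Triple S a b c → a ~ b →
                     ¬ Branch H a → ¬ Branch H b → ¬ (∃[ y ] c ~ y) → Alternative
      matched-pair {a} {b} {c} tr ab ¬ba ¬bb ¬c =
        inj₂ (Lower.OneDeficient⁺.trees simple isComplement (flip₂₃ tr) a
          (joined a≢c λ ac → ¬c (a , ~-sym ac))
          (joined (≢-sym b≢c) λ cb → ¬c (b , cb))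
          (λ _ cv → ¬c (_ , cv))
          (λ {v} o bv → o (subst (_∈ₛ S) (unbranched ¬bb (~-sym ab) bv) a∈))
          (λ {v} o av → ⊥-elim (o (subst (_∈ₛ S) (unbranched ¬ba ab av) b∈))))
        where open Triple tr

      -- Once both obstructions are excluded, exactly one edge of H meets S: it lies inside S, which
      -- is `matched-pair`, or it is ax with x outside S, whose star is repaired by ac.
      with-neighbour : ∀ {a b c x} → Triple S a b c → a ~ x → Alternative
      with-neighbour {a} {b} {c} {x} tr ax with branch? a
      ... | yes ba = inj₁ (deficient tr (inj₁ ba))
      ... | no ¬ba with branch? b | branch? c
      ... | yes bb | _ = inj₁ (deficient (rotate tr) (inj₁ bb))
      ... | no _ | yes bc = inj₁ (deficient (rotate (rotate tr)) (inj₁ bc))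
      ... | no ¬bb | no ¬bc with neighbour? b | neighbour? c | a ~? b | a ~? c
      ... | yes nb | _ | no ¬ab | _ = inj₁ (deficient tr (inj₂ (¬ab , (x , ax) , nb)))
      ... | _ | yes nc | _ | no ¬ac = inj₁ (deficient (flip₂₃ tr) (inj₂ (¬ac , (x , ax) , nc)))
      ... | _ | _ | yes ab | yes ac = contradiction (unbranched ¬ba ab ac) (Triple.b≢c tr)
      ... | _ | no ¬nc | yes ab | no _ = matched-pair tr ab ¬ba ¬bb ¬nc
      ... | no ¬nb | _ | no _ | yes ac = matched-pair (flip₂₃ tr) ac ¬ba ¬bc ¬nb
      ... | no ¬nb | no ¬nc | no ¬ab | no ¬ac =
        inj₂ (Lower.OneDeficient⁺.trees simple isComplement tr x (joined a≢b ¬ab) (joined b≢c λ bc → ¬nb (c , bc))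
          (λ _ bv → ¬nb (_ , bv)) (λ _ cv → ¬nc (_ , cv))
          (λ _ av → unbranched ¬ba av ax , joined a≢c ¬ac))
        where open Triple tr

    deficient-or-1+k-trees : ∀ {a b c} → Triple S a b c → Deficient S ⊎ HasTrees G S (1 + k)
    deficient-or-1+k-trees {a} {b} {c} tr with neighbour? a | neighbour? b | neighbour? c
    ... | yes (_ , ax) | _ | _ = with-neighbour tr ax
    ... | no _ | yes (_ , bx) | _ = with-neighbour (rotate tr) bx
    ... | no _ | no _ | yes (_ , cx) = with-neighbour (rotate (rotate tr)) cx
    ... | no ¬na | no ¬nb | no ¬nc =
      inj₂ (Lower.OneDeficient⁺.trees simple isComplement tr a
        (joined a≢b λ ab → ¬na (b , ab)) (joined b≢c λ bc → ¬nb (c , bc))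
        (λ _ bv → ¬nb (_ , bv)) (λ _ cv → ¬nc (_ , cv)) (λ _ av → contradiction (_ , av) ¬na))
      where open Triple tr

  module _ (sparse : Sparse H) {S : Subset (3 + k)} where

    open Sparse sparse
    open Lower simple isComplement {S}

    private
      -- Since a already has the neighbours x and b, it is not adjacent to c, and c is no branch
      -- because branches are adjacent. If b and c are adjacent in H, only the spoke ax is broken
      -- and ac repairs it. Otherwise b and c may each miss one more vertex, and x serves as the
      -- hub.
      path-case : ∀ {a b c x} → Triple S a b c → Outer x → a ~ x → a ~ b → HasTrees G S k
      path-case {a} {b} {c} {x} tr o ax ab = go
        where
        open Triple tr

        x≢ : ∀ {v} → v ∈ₛ S → x ≢ v
        x≢ v∈ refl = o v∈

        x≢b = x≢ b∈

        branch-a : Branch H a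
        branch-a = x , b , x≢b , ax , ab

        ¬ac : ¬ a ~ c
        ¬ac ac = degree≤2 ax ab ac x≢b (x≢ c∈) b≢c

        ¬branch-c : ¬ Branch H c
        ¬branch-c bc = ¬ac (branches-adjacent a≢c branch-a bc)

        outer≢ : ∀ {u v} → Outer v → u ∈ₛ S → u ≢ v
        outer≢ o u∈ refl = o u∈

        a-only : ∀ {v} → Outer v → a ~ v → v ≡ x
        a-only {v} o′ av with v ≟ x
        ... | yes p = p
        ... | no ¬p = ⊥-elim (degree≤2 ax ab av x≢b (≢-sym ¬p) (outer≢ o′ b∈))

        go : HasTrees G S k
        go with b ~? c
        ... | yes bc = OneDeficient.trees tr x x
          (λ o′ bv → degree≤2 (~-sym ab) bc bv a≢c (outer≢ o′ a∈) (outer≢ o′ c∈))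
          (λ o′ cv → ¬branch-c (b , _ , outer≢ o′ b∈ , ~-sym bc , cv))
          (λ o′ av → inj₂ (a-only o′ av , joined a≢c ¬ac))
        ... | no ¬bc = Hub.trees tr x o (joined a≢c ¬ac) (joined b≢c ¬bc)
          (λ o′ v≢x av → contradiction (a-only o′ av) v≢x)
          -- If xv were in H, then x and b would both be branches and hence adjacent, giving b the
          -- three neighbours a, v and x.
          (λ o′ v≢x bv →
              joined (≢-sym x≢b) (¬bx o′ v≢x bv)
            , joined (≢-sym v≢x) λ xv → ¬bx o′ v≢x bv (branches-adjacent (≢-sym x≢b)
                (a , _ , outer≢ o′ a∈ , ~-sym ab , bv) (a , _ , outer≢ o′ a∈ , ~-sym ax , xv)))
          (λ o′ v≢x cv →
              joined (≢-sym (x≢ c∈)) (λ cx → ¬branch-c (_ , x , v≢x , cv , cx))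
            , joined (≢-sym v≢x) λ xv → v≢x (a-only o′
                (branches-adjacent (outer≢ o′ a∈) branch-a (x , c , x≢ c∈ , ~-sym xv , ~-sym cv))))
          (λ o₁ v≢x _ _ av _ → contradiction (a-only o₁ av) v≢x)
          (λ {v} {w} o₁ _ o₂ _ bv bw → case v ≟ w of λ where
            (yes p) → p
            (no ¬p) → ⊥-elim (degree≤2 (~-sym ab) bv bw (outer≢ o₁ a∈) (outer≢ o₂ a∈) ¬p))
          (λ _ _ _ _ cv cw → unbranched ¬branch-c cv cw)
          where
          ¬bx : ∀ {v} → Outer v → v ≢ x → b ~ v → ¬ b ~ x
          ¬bx o′ v≢x bv bx = degree≤2 (~-sym ab) bv bx (outer≢ o′ a∈) (≢-sym (x≢ a∈)) v≢x

      -- The neighbours of a are used up outside S, so b and c are not adjacent to a and hence no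
      -- branches. If they are adjacent in H, their spokes are whole and ab, ac repair the stars at
      -- x and y; otherwise up to four spokes are broken and x is the hub.
      fork-case : ∀ {a b c x y} → Triple S a b c → Outer x → Outer y → x ≢ y → a ~ x → a ~ y → HasTrees G S k
      fork-case {a} {b} {c} {x} {y} tr ox oy x≢y ax ay = go
        where
        open Triple tr

        outer≢ : ∀ {u v} → Outer v → u ∈ₛ S → u ≢ v
        outer≢ o u∈ refl = o u∈

        branch-a : Branch H a
        branch-a = x , y , x≢y , ax , ay

        a-only : ∀ {v} → a ~ v → v ≢ x → v ≡ y
        a-only {v} av v≢x with v ≟ y
        ... | yes p = p
        ... | no ¬p = ⊥-elim (degree≤2 ax ay av x≢y (≢-sym v≢x) (≢-sym ¬p))

        ¬a~ : ∀ {s} → s ∈ₛ S → ¬ a ~ s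
        ¬a~ s∈ as = outer≢ oy s∈ (a-only as (outer≢ ox s∈))

        ¬branch : ∀ {s} → s ∈ₛ S → a ≢ s → ¬ Branch H s
        ¬branch s∈ a≢s bs = ¬a~ s∈ (branches-adjacent a≢s branch-a bs)

        -- The edge sx is in G because s is no branch. If xv were in H, then v would be a branch,
        -- thus adjacent to a, and have the three neighbours s, x and a.
        repair : ∀ {s} → s ∈ₛ S → a ≢ s → ∀ {v} → Outer v → v ≢ x → s ~ v → G s x ≡ true × G x v ≡ true
        repair {s} s∈ a≢s {v} o v≢x sv =
            joined (outer≢ ox s∈) (λ sx → ¬branch s∈ a≢s (v , x , v≢x , sv , sx))
          , joined (≢-sym v≢x) λ xv → degree≤2 (~-sym sv) (~-sym xv)
              (~-sym (branches-adjacent (outer≢ o a∈) branch-a (s , x , outer≢ ox s∈ , ~-sym sv , ~-sym xv)))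
              (outer≢ ox s∈) (≢-sym a≢s) (≢-sym (outer≢ ox a∈))

        go : HasTrees G S k
        go with b ~? c
        ... | yes bc = OneDeficient.trees tr x y
          (λ o bv → ¬branch b∈ a≢b (c , _ , outer≢ o c∈ , bc , bv))
          (λ o cv → ¬branch c∈ a≢c (b , _ , outer≢ o b∈ , ~-sym bc , cv))
          (λ {v} o av → case v ≟ x of λ where
            (yes p) → inj₁ (p , joined a≢b (¬a~ b∈))
            (no ¬p) → inj₂ (a-only av ¬p , joined a≢c (¬a~ c∈)))
        ... | no ¬bc = Hub.trees tr x ox (joined a≢c (¬a~ c∈)) (joined b≢c ¬bc)
          (λ _ _ _ → joined a≢b (¬a~ b∈)) (repair b∈ a≢b) (repair c∈ a≢c)
          (λ _ v≢x _ w≢x av aw → trans (a-only av v≢x) (sym (a-only aw w≢x)))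
          (λ _ _ _ _ → unbranched (¬branch b∈ a≢b))
          (λ _ _ _ _ → unbranched (¬branch c∈ a≢c))

      -- Degree two with at least one neighbour outside S. A second neighbour outside S leads to
      -- `fork-case`, one inside S to `path-case`.
      Heavy : Fin (3 + k) → Set
      Heavy s = ∃[ x ] ∃[ y ] (Outer x × x ≢ y × s ~ x × s ~ y)

      heavy? : ∀ s → Dec (Heavy s)
      heavy? s = any? λ x → any? λ y → ¬? (x ∈ₛ? S) ×-dec ¬? (x ≟ y) ×-dec (s ~? x) ×-dec (s ~? y)

      light : ∀ {s v w} → ¬ Heavy s → Outer v → s ~ v → s ~ w → v ≡ w
      light {s} {v} {w} ¬h o sv sw with v ≟ w
      ... | yes p = p
      ... | no ¬p = contradiction (v , w , o , ¬p , sv , sw) ¬h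

      heavy-case : ∀ {a b c} → Triple S a b c → Heavy a → HasTrees G S k
      heavy-case tr (x , y , o , x≢y , ax , ay) with y ∈ₛ? S
      ... | no oy = fork-case tr o oy x≢y ax ay
      ... | yes y∈ with Triple.covers tr y∈
      ... | 0th = contradiction refl (~⇒≢ ay)
      ... | 1st = path-case tr o ax ay
      ... | 2nd = path-case (flip₂₃ tr) o ax ay

      -- Neither a nor b is heavy, so being adjacent in H they miss nothing outside S. At most one
      -- spoke is broken, at c, and then the edge ca is in G and repairs it.
      pair-case : ∀ {a b c} → Triple S a b c → ¬ Heavy a → ¬ Heavy b → ¬ Heavy c → a ~ b → HasTrees G S k
      pair-case {a} {b} {c} tr ¬ha ¬hb ¬hc ab with any? (λ v → ¬? (v ∈ₛ? S) ×-dec (c ~? v))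
      ... | yes (z , o , cz) = OneDeficient.trees (rotate (rotate tr)) z z
          (λ o′ av → o′ (subst (_∈ₛ S) (sym (light ¬ha o′ av ab)) b∈))
          (λ o′ bv → o′ (subst (_∈ₛ S) (sym (light ¬hb o′ bv (~-sym ab))) a∈))
          (λ o′ cv → inj₁ (light ¬hc o′ cv cz
            , joined (≢-sym a≢c) λ ca → o (subst (_∈ₛ S) (sym (light ¬hc o cz ca)) a∈)))
        where open Triple tr
      ... | no ∄ = OneDeficient.trees (rotate (rotate tr)) c c
          (λ o′ av → o′ (subst (_∈ₛ S) (sym (light ¬ha o′ av ab)) b∈))
          (λ o′ bv → o′ (subst (_∈ₛ S) (sym (light ¬hb o′ bv (~-sym ab))) a∈))
          (λ o′ cv → contradiction (_ , o′ , cv) ∄)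
        where open Triple tr

    -- With no heavy vertex and no edge of H inside S, G contains the whole triangle on S and each
    -- vertex of S misses at most one outside vertex, which is the situation of `Cyclic`.
    k-trees : ∀ {a b c} → Triple S a b c → HasTrees G S k
    k-trees {a} {b} {c} tr with heavy? a | heavy? b | heavy? c
    ... | yes ha | _ | _ = heavy-case tr ha
    ... | no _ | yes hb | _ = heavy-case (rotate tr) hb
    ... | no _ | no _ | yes hc = heavy-case (rotate (rotate tr)) hc
    ... | no ¬ha | no ¬hb | no ¬hc with a ~? b | b ~? c | c ~? a
    ... | yes ab | _ | _ = pair-case tr ¬ha ¬hb ¬hc ab
    ... | no _ | yes bc | _ = pair-case (rotate tr) ¬hb ¬hc ¬ha bc
    ... | no _ | no _ | yes ca = pair-case (rotate (rotate tr)) ¬hc ¬ha ¬hb ca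
    ... | no ¬ab | no ¬bc | no ¬ca = Cyclic.trees tr
        (joined a≢b ¬ab) (joined b≢c ¬bc) (joined (≢-sym a≢c) ¬ca)
        (λ o _ → light ¬ha o) (λ o _ → light ¬hb o) (λ o _ → light ¬hc o)
        (λ av bv cv → degree≤2 (~-sym av) (~-sym bv) (~-sym cv) a≢b a≢c b≢c)
      where open Triple tr

  λ₃⇒sparse : Connected G → LambdaK G 3 k → Sparse H × TwoEdges H
  λ₃⇒sparse connected (minimum , _) = record { degree≤2 = degree≤2 ; branches-adjacent = adjacent } , two
    where
    packed : ∀ {a b c} → a ≢ b → a ≢ c → b ≢ c → ∃[ S ] (Triple S a b c × HasTrees G S k)
    packed a≢b a≢c b≢c with fromDistinct a≢b a≢c b≢c
    ... | S , card , tr with proj₁ (minimum connected) S card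
    ... | m , (h , _) , k≤m = S , tr , hasTrees-mono k≤m h

    degree≤2 : ∀ {u x y z} → u ~ x → u ~ y → u ~ z → x ≢ y → x ≢ z → y ≢ z → ⊥
    degree≤2 {u} {x} {y} {z} ux uy uz x≢y x≢z y≢z with packed (~⇒≢ ux) (~⇒≢ uy) x≢y
    ... | S , tr , h = ≤⇒≯ (Upper.At.degree-bound S h (Triple.a∈ tr) (Triple.b∈ tr) (~⇒≢ ux)
        {M = u ∷ x ∷ y ∷ z ∷ []}
        ((~⇒≢ ux ∷ ~⇒≢ uy ∷ ~⇒≢ uz ∷ []) ∷ (x≢y ∷ x≢z ∷ []) ∷ (y≢z ∷ []) ∷ [] ∷ [])
        (proj₂ simple u ∷ ~⇒missing ux ∷ ~⇒missing uy ∷ ~⇒missing uz ∷ [])) ≤-refl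

    adjacent : ∀ {u v} → u ≢ v → Branch H u → Branch H v → u ~ v
    adjacent {u} {v} u≢v (x , y , x≢y , ux , uy) (x′ , y′ , x′≢y′ , vx′ , vy′) with u ~? v
    ... | yes uv = uv
    -- The neighbour x of u serves as third vertex of S; it differs from v since u and v are not
    -- adjacent in H.
    ... | no ¬uv with packed u≢v (~⇒≢ ux) (λ { refl → ¬uv ux })
    ... | S , tr , h = ⊥-elim (Upper.tight-pair S h (Triple.a∈ tr) (Triple.b∈ tr) (Triple.c∈ tr)
        u≢v (Triple.a≢c tr) (Triple.b≢c tr)
        {M = u ∷ x ∷ y ∷ []} {N = v ∷ x′ ∷ y′ ∷ []}
        ((~⇒≢ ux ∷ ~⇒≢ uy ∷ []) ∷ (x≢y ∷ []) ∷ [] ∷ [])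
        (proj₂ simple u ∷ ~⇒missing ux ∷ ~⇒missing uy ∷ []) ≤-refl
        ((~⇒≢ vx′ ∷ ~⇒≢ vy′ ∷ []) ∷ (x′≢y′ ∷ []) ∷ [] ∷ [])
        (proj₂ simple v ∷ ~⇒missing vx′ ∷ ~⇒missing vy′ ∷ []) ≤-refl
        (joined u≢v ¬uv))

    two : TwoEdges H
    two with proj₂ (minimum connected)
    ... | S , card , _ , maximal with toTriple S card
    ... | _ , _ , _ , tr with deficient-or-1+k-trees tr
    ... | inj₁ d = deficient⇒twoEdges d
    ... | inj₂ h = contradiction h maximal

  sparse⇒λ₃ : Connected G → Sparse H → TwoEdges H → LambdaK G 3 k
  sparse⇒λ₃ connected sparse two = (λ _ → all , exact) , λ ¬c → contradiction connected ¬c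
    where
    all : ∀ S → ∣ S ∣ ≡ 3 → ∃[ m ] (LambdaS G S m × k ≤ m)
    all S card with toTriple S card
    ... | _ , _ , _ , tr with deficient-or-1+k-trees tr
    ... | inj₁ d = k , (k-trees sparse tr , no-1+k-trees d) , ≤-refl
    ... | inj₂ h = 1 + k , (h , no-2+k-trees tr) , n≤1+n k

    exact : ∃[ S ] (∣ S ∣ ≡ 3 × LambdaS G S k)
    exact with twoEdges⇒deficient two
    ... | S , card , d = S , card , k-trees sparse (Deficient.tr d) , no-1+k-trees d

-- Disjoint unions

module _ {a b : ℕ} (G : Graph a) (H : Graph b) where

  ∪-left : ∀ x y → (G ∪ H) (x ↑ˡ b) (y ↑ˡ b) ≡ G x y
  ∪-left x y rewrite splitAt-↑ˡ a x b | splitAt-↑ˡ a y b = refl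

  ∪-edge : ∀ {u v} → (G ∪ H) u v ≡ true →
    (∃[ x ] ∃[ y ] (u ≡ x ↑ˡ b × v ≡ y ↑ˡ b × G x y ≡ true)) ⊎
    (∃[ x ] ∃[ y ] (u ≡ a ↑ʳ x × v ≡ a ↑ʳ y × H x y ≡ true))
  ∪-edge {u} {v} e with splitAt a u in p | splitAt a v in q
  ... | inj₁ x | inj₁ y = inj₁ (x , y , sym (splitAt⁻¹-↑ˡ p) , sym (splitAt⁻¹-↑ˡ q) , e)
  ... | inj₂ x | inj₂ y = inj₂ (x , y , sym (splitAt⁻¹-↑ʳ {m = a} p) , sym (splitAt⁻¹-↑ʳ {m = a} q) , e)

↑ˡ≢↑ʳ : ∀ {a b} (x : Fin a) (y : Fin b) → x ↑ˡ b ≢ a ↑ʳ y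
↑ˡ≢↑ʳ {a} {b} x y eq =
  case trans (sym (splitAt-↑ˡ a x b)) (trans (cong (splitAt a) eq) (splitAt-↑ʳ a b y)) of λ ()

Matching : Graph n → Set
Matching H = ∀ {u v w} → H u v ≡ true → H u w ≡ true → v ≡ w

∪-matching : {G : Graph n} {H : Graph m} → Matching G → Matching H → Matching (G ∪ H)
∪-matching {n} {m} {G = G} {H} mG mH e f with ∪-edge G H e | ∪-edge G H f
... | inj₁ (_ , _ , refl , refl , p) | inj₁ (_ , _ , eq , refl , q)
  with refl ← ↑ˡ-injective m _ _ eq = cong (_↑ˡ m) (mG p q)
... | inj₂ (_ , _ , refl , refl , p) | inj₂ (_ , _ , eq , refl , q)
  with refl ← ↑ʳ-injective n _ _ eq = cong (n ↑ʳ_) (mH p q)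
... | inj₁ (_ , _ , refl , _) | inj₂ (_ , _ , eq , _) = contradiction eq (↑ˡ≢↑ʳ _ _)
... | inj₂ (_ , _ , refl , _) | inj₁ (_ , _ , eq , _) = contradiction (sym eq) (↑ˡ≢↑ʳ _ _)

copies-matching : ∀ r {H : Graph m} → Matching H → Matching (copies r H)
copies-matching zero    mH {()}
copies-matching (suc r) mH = ∪-matching mH (copies-matching r mH)

P₂-matching : Matching (P 2)
P₂-matching {A} {B} {B} _ _ = refl
P₂-matching {B} {A} {A} _ _ = refl
P₂-matching {B} {B} {_} () _
P₂-matching {B} {A} {B} _ ()

pairs-matching : ∀ r q → Matching (copies r (P 2) ∪ copies q K₁)
pairs-matching r q = ∪-matching (copies-matching r (λ {u v w} → P₂-matching {u} {v} {w})) (copies-matching q λ ())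

copies-K₁-empty : ∀ q {u v} → copies q K₁ u v ≢ true
copies-K₁-empty zero {()}
copies-K₁-empty (suc q) {u} {v} e with ∪-edge K₁ (copies q K₁) {u} {v} e
... | inj₂ (x , y , _ , _ , f) = copies-K₁-empty q {x} {y} f

matching-sparse : {H : Graph n} → Matching H → Sparse H
matching-sparse mH = record
  { degree≤2 = λ ux uy _ x≢y _ _ → x≢y (mH ux uy)
  ; branches-adjacent = λ _ (x , y , x≢y , ux , uy) → contradiction (mH ux uy) x≢y
  }

-- A matching has no branch, so all branches lie in the part of G, and every edge at them stays
-- there.
∪-sparse : {G : Graph n} {H : Graph m} → Sparse G → Matching H → Sparse (G ∪ H)
∪-sparse {n} {m} {G = G} {H} sG mH = record { degree≤2 = degree ; branches-adjacent = adjacent }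
  where
  open Sparse sG

  branch-left : ∀ {u} → Branch (G ∪ H) u → ∃[ x ] (u ≡ x ↑ˡ m × Branch G x)
  branch-left (v , w , v≢w , e , f) with ∪-edge G H e | ∪-edge G H f
  ... | inj₁ (x , y , refl , refl , p) | inj₁ (_ , z , eq , refl , q)
    with refl ← ↑ˡ-injective m _ _ eq = _ , refl , y , z , v≢w ∘ cong (_↑ˡ m) , p , q
  ... | inj₂ (_ , _ , refl , refl , p) | inj₂ (_ , _ , eq , refl , q)
    with refl ← ↑ʳ-injective n _ _ eq = contradiction (cong (n ↑ʳ_) (mH p q)) v≢w
  ... | inj₁ (_ , _ , refl , _) | inj₂ (_ , _ , eq , _) = contradiction eq (↑ˡ≢↑ʳ _ _)
  ... | inj₂ (_ , _ , refl , _) | inj₁ (_ , _ , eq , _) = contradiction (sym eq) (↑ˡ≢↑ʳ _ _)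

  left-edge : ∀ {x v} → (G ∪ H) (x ↑ˡ m) v ≡ true → ∃[ y ] (v ≡ y ↑ˡ m × G x y ≡ true)
  left-edge e with ∪-edge G H e
  ... | inj₁ (_ , y , eq , refl , p) with refl ← ↑ˡ-injective m _ _ eq = y , refl , p
  ... | inj₂ (_ , _ , eq , _) = contradiction eq (↑ˡ≢↑ʳ _ _)

  degree : ∀ {u x y z} → (G ∪ H) u x ≡ true → (G ∪ H) u y ≡ true → (G ∪ H) u z ≡ true →
           x ≢ y → x ≢ z → y ≢ z → ⊥
  degree e f g x≢y x≢z y≢z with branch-left (_ , _ , x≢y , e , f)
  ... | _ , refl , _ with left-edge e | left-edge f | left-edge g
  ... | _ , refl , p | _ , refl , q | _ , refl , r =
    degree≤2 p q r (x≢y ∘ cong (_↑ˡ m)) (x≢z ∘ cong (_↑ˡ m)) (y≢z ∘ cong (_↑ˡ m))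

  adjacent : ∀ {u v} → u ≢ v → Branch (G ∪ H) u → Branch (G ∪ H) v → (G ∪ H) u v ≡ true
  adjacent u≢v bu bv with branch-left bu | branch-left bv
  ... | x , refl , bx | y , refl , by =
    trans (∪-left G H x y) (branches-adjacent (u≢v ∘ cong (_↑ˡ m)) bx by)

∪-twoEdgesˡ : {G : Graph n} {H : Graph m} → TwoEdges G → TwoEdges (G ∪ H)
∪-twoEdgesˡ {m = m} {G} {H} (u , v , w , z , uv , wz , w≢u , w≢v) =
  u ↑ˡ m , v ↑ˡ m , w ↑ˡ m , z ↑ˡ m , trans (∪-left G H u v) uv , trans (∪-left G H w z) wz ,
  w≢u ∘ ↑ˡ-injective m w u , w≢v ∘ ↑ˡ-injective m w v

pairs-twoEdges : ∀ r q → 2 ≤ r → TwoEdges (copies r (P 2) ∪ copies q K₁)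
pairs-twoEdges (suc (suc r)) q (s≤s (s≤s _)) =
  ∪-twoEdgesˡ (A , B , C , X , refl , refl , (λ ()) , λ ())

sparse-≅ : {H : Graph n} {K : Graph m} → H ≅ K → Sparse K → Sparse H
sparse-≅ {H = H} {K} (f , H≡K) sK = record
  { degree≤2 = λ e g h x≢y x≢z y≢z →
      degree≤2 (push e) (push g) (push h) (x≢y ∘ to-injective) (x≢z ∘ to-injective) (y≢z ∘ to-injective)
  ; branches-adjacent = λ u≢v bu bv →
      trans (H≡K _ _) (branches-adjacent (u≢v ∘ to-injective) (push-branch bu) (push-branch bv))
  }
  where
  open Sparse sK
  open Inverse f using (to; from; strictlyInverseʳ)

  to-injective : ∀ {u v} → to u ≡ to v → u ≡ v
  to-injective eq = trans (sym (strictlyInverseʳ _)) (trans (cong from eq) (strictlyInverseʳ _))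

  push : ∀ {u v} → H u v ≡ true → K (to u) (to v) ≡ true
  push = trans (sym (H≡K _ _))

  push-branch : ∀ {u} → Branch H u → Branch K (to u)
  push-branch (x , y , x≢y , ux , uy) = to x , to y , x≢y ∘ to-injective , push ux , push uy

twoEdges-≅ : {H : Graph n} {K : Graph m} → H ≅ K → TwoEdges K → TwoEdges H
twoEdges-≅ {H = H} {K} (f , H≡K) (u , v , w , z , uv , wz , w≢u , w≢v) =
  from u , from v , from w , from z , pull uv , pull wz , w≢u ∘ from-injective , w≢v ∘ from-injective
  where
  open Inverse f using (to; from; strictlyInverseˡ)

  from-injective : ∀ {i j} → from i ≡ from j → i ≡ j
  from-injective eq = trans (sym (strictlyInverseˡ _)) (trans (cong to eq) (strictlyInverseˡ _))

  pull : ∀ {i j} → K i j ≡ true → H (from i) (from j) ≡ true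
  pull e = trans (H≡K _ _) (trans (cong₂ K (strictlyInverseˡ _) (strictlyInverseˡ _)) e)

module _ (H : Graph n) where
  open Adjacency H

  degree≤2? : Dec (∀ u x y z → u ~ x → u ~ y → u ~ z → x ≢ y → x ≢ z → y ≢ z → ⊥)
  degree≤2? = all? λ u → all? λ x → all? λ y → all? λ z →
    -- The final `y ≢ z → ⊥` is itself a negation, hence the doubled `¬?`.
    (u ~? x) →-dec (u ~? y) →-dec (u ~? z) →-dec ¬? (x ≟ y) →-dec ¬? (x ≟ z) →-dec ¬? (¬? (y ≟ z))

  branches-adjacent? : Dec (∀ u v → u ≢ v → Branch H u → Branch H v → u ~ v)
  branches-adjacent? = all? λ u → all? λ v → ¬? (u ≟ v) →-dec branch? u →-dec branch? v →-dec (u ~? v)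

  sparse? : Dec (Sparse H)
  sparse? = map′
    (λ (d , b) → record { degree≤2 = d _ _ _ _ ; branches-adjacent = b _ _ })
    (λ s → (λ _ _ _ _ → Sparse.degree≤2 s) , (λ _ _ → Sparse.branches-adjacent s))
    (degree≤2? ×-dec branches-adjacent?)

P₃-sparse : Sparse (P 3)
P₃-sparse = from-yes (sparse? (P 3))

P₄-sparse : Sparse (P 4)
P₄-sparse = from-yes (sparse? (P 4))

C₃-sparse : Sparse C₃
C₃-sparse = from-yes (sparse? C₃)

P₃-twoEdges : TwoEdges (P 3)
P₃-twoEdges = A , B , C , B , refl , refl , (λ ()) , λ ()

P₄-twoEdges : TwoEdges (P 4)
P₄-twoEdges = A , B , C , B , refl , refl , (λ ()) , λ ()

C₃-twoEdges : TwoEdges C₃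
C₃-twoEdges = A , B , C , B , refl , refl , (λ ()) , λ ()

-- Embeddings onto a given list of vertices

record Embeds (H : Graph n) (K : Graph m) (vs : List (Fin n)) : Set where
  field
    e : Fin m → Fin n
    injective : ∀ {i j} → e i ≡ e j → i ≡ j
    faithful : ∀ i j → H (e i) (e j) ≡ K i j
    image : ∀ i → e i ∈ vs
    onto : ∀ {v} → v ∈ vs → ∃[ i ] e i ≡ v

embeds-lookup : {H : Graph n} {vs : List (Fin n)} {K : Graph (length vs)} → Unique vs →
                (∀ i j → H (lookup vs i) (lookup vs j) ≡ K i j) → Embeds H K vs
embeds-lookup {vs = vs} vs! faithful = record
  { e = lookup vs
  ; injective = lookup-injective vs! _ _
  ; faithful = faithful
  ; image = ∈-lookup
  ; onto = λ v∈ → Any.index v∈ , sym (lookup-index v∈)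
  }

embeds-≅ : {H : Graph n} {K : Graph m} {vs : List (Fin n)} → (∀ v → v ∈ vs) → Embeds H K vs → H ≅ K
embeds-≅ {H = H} {K} all em = mk↔ₛ′ to e (λ i → injective (e∘to (e i))) e∘to , λ u v →
  trans (sym (cong₂ H (e∘to u) (e∘to v))) (faithful (to u) (to v))
  where
  open Embeds em
  to : Fin _ → Fin _
  to v = proj₁ (onto (all v))
  e∘to : ∀ v → e (to v) ≡ v
  e∘to v = proj₂ (onto (all v))

embeds-∪ : {H : Graph n} {a b : ℕ} {K : Graph a} {L : Graph b} {us vs : List (Fin n)} →
  (∀ {u v} → u ∈ us → v ∈ vs → u ≢ v × H u v ≡ false × H v u ≡ false) →
  Embeds H K us → Embeds H L vs → Embeds H (K ∪ L) (us ++ vs)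
embeds-∪ {n} {H} {a} {b} {K} {L} {us} {vs} apart eK eL = record
  { e = e
  ; injective = λ {i} {j} → injective i j
  ; faithful = faithful
  ; image = image
  ; onto = onto
  }
  where
  module K = Embeds eK
  module L = Embeds eL

  e : Fin (a + b) → Fin n
  e i = [ K.e , L.e ]′ (splitAt a i)

  injective : ∀ i j → e i ≡ e j → i ≡ j
  injective i j eq with splitAt a i in p | splitAt a j in q
  ... | inj₁ x | inj₁ y =
    trans (sym (splitAt⁻¹-↑ˡ p)) (trans (cong (_↑ˡ b) (K.injective eq)) (splitAt⁻¹-↑ˡ q))
  ... | inj₂ x | inj₂ y =
    trans (sym (splitAt⁻¹-↑ʳ {m = a} p)) (trans (cong (a ↑ʳ_) (L.injective eq)) (splitAt⁻¹-↑ʳ {m = a} q))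
  ... | inj₁ x | inj₂ y = contradiction eq (proj₁ (apart (K.image x) (L.image y)))
  ... | inj₂ x | inj₁ y = contradiction (sym eq) (proj₁ (apart (K.image y) (L.image x)))

  faithful : ∀ i j → H (e i) (e j) ≡ (K ∪ L) i j
  faithful i j with splitAt a i | splitAt a j
  ... | inj₁ x | inj₁ y = K.faithful x y
  ... | inj₂ x | inj₂ y = L.faithful x y
  ... | inj₁ x | inj₂ y = proj₁ (proj₂ (apart (K.image x) (L.image y)))
  ... | inj₂ x | inj₁ y = proj₂ (proj₂ (apart (K.image y) (L.image x)))

  image : ∀ i → e i ∈ us ++ vs
  image i with splitAt a i
  ... | inj₁ x = ∈-++⁺ˡ (K.image x)
  ... | inj₂ y = ∈-++⁺ʳ us (L.image y)

  onto : ∀ {v} → v ∈ us ++ vs → ∃[ i ] e i ≡ v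
  onto v∈ with ∈-++⁻ us v∈
  ... | inj₁ p with K.onto p
  ... | x , refl = x ↑ˡ b , cong [ K.e , L.e ]′ (splitAt-↑ˡ a x b)
  onto v∈ | inj₂ p with L.onto p
  ... | y , refl = a ↑ʳ y , cong [ K.e , L.e ]′ (splitAt-↑ʳ a b y)

-- Classification of sparse graphs

module Classify {n} {H : Graph n} (irrefl : ∀ {u v} → H u v ≡ true → u ≢ v)
  (symm : ∀ {u v} → H u v ≡ true → H v u ≡ true) where

  open Adjacency H

  off : ∀ {u v} → ¬ u ~ v → H u v ≡ false
  off = ¬-not

  -- Pairs and isolated vertices turn up interleaved, whereas the target graph lists all pairs
  -- first. They are therefore collected separately, and `apart` allows joining the two parts at the
  -- end.
  record PairsAndPoints (xs : List (Fin n)) : Set where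
    field
      {r q} : ℕ
      {ps ss} : List (Fin n)
      pairs : Embeds H (copies r (P 2)) ps
      points : Embeds H (copies q K₁) ss
      split : ∀ {v} → v ∈ xs → v ∈ ps ⊎ v ∈ ss
      ps⊆ : ∀ {v} → v ∈ ps → v ∈ xs
      ss⊆ : ∀ {v} → v ∈ ss → v ∈ xs
      apart : ∀ {u v} → u ∈ ps → v ∈ ss → u ≢ v × H u v ≡ false × H v u ≡ false

  nothing-embeds : ∀ {K : Graph 0} → Embeds H K []
  nothing-embeds = embeds-lookup [] λ ()

  non-adjacent : ∀ {u v} → ¬ u ~ v → H u v ≡ false × H v u ≡ false
  non-adjacent ¬uv = off ¬uv , off (¬uv ∘ symm)

  -- The head u either takes its only neighbour as partner or is isolated in xs. The partner is
  -- removed by filtering, which is not structural recursion, hence the fuel.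
  decompose : ∀ fuel xs → length xs ≤ fuel → Unique xs →
              (∀ {u v w} → u ∈ xs → u ~ v → u ~ w → v ≡ w) → PairsAndPoints xs
  decompose _ [] _ _ _ = record
    { r = 0 ; q = 0 ; pairs = nothing-embeds ; points = nothing-embeds
    ; split = λ () ; ps⊆ = λ () ; ss⊆ = λ () ; apart = λ () }
  decompose (suc fuel) (u ∷ xs) (s≤s len) (u∉ ∷ xs!) once with any? (λ v → (v ∈? xs) ×-dec (u ~? v))
  ... | yes (v , v∈ , uv) = record
    { r = suc r ; q = q
    ; pairs = embeds-∪ (λ s∈ → separate s∈ ∘ ps⊆) pair pairs
    ; points = points
    ; split = split′
    ; ps⊆ = λ { 0th → 0th ; 1st → there v∈ ; (there (there p)) → there (proj₁ (rest⊆ (ps⊆ p))) }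
    ; ss⊆ = λ p → there (proj₁ (rest⊆ (ss⊆ p)))
    ; apart = λ
        { 0th q → separate 0th (ss⊆ q)
        ; 1st q → separate 1st (ss⊆ q)
        ; (there (there p)) q → apart p q }
    }
    where
    rest = filter (λ w → ¬? (w ≟ v)) xs

    rest⊆ : ∀ {w} → w ∈ rest → w ∈ xs × w ≢ v
    rest⊆ = ∈-filter⁻ (λ w → ¬? (w ≟ v)) {xs = xs}

    open PairsAndPoints (decompose fuel rest (≤-trans (length-filter _ xs) len) (Unique.filter⁺ _ xs!)
      (once ∘ there ∘ proj₁ ∘ rest⊆))

    pair : Embeds H (P 2) (u ∷ v ∷ [])
    pair = embeds-lookup ((irrefl uv ∷ []) ∷ [] ∷ []) λ where
      A A → off (λ e → irrefl e refl)
      A B → uv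
      B A → symm uv
      B B → off (λ e → irrefl e refl)

    separate : ∀ {s w} → s ∈ u ∷ v ∷ [] → w ∈ rest → s ≢ w × H s w ≡ false × H w s ≡ false
    separate 0th w∈ = All.lookup u∉ (proj₁ (rest⊆ w∈)) ,
      non-adjacent λ uw → proj₂ (rest⊆ w∈) (once 0th uw uv)
    separate 1st w∈ = ≢-sym (proj₂ (rest⊆ w∈)) ,
      non-adjacent λ vw → All.lookup u∉ (proj₁ (rest⊆ w∈)) (once (there v∈) (symm uv) vw)

    split′ : ∀ {w} → w ∈ u ∷ xs → w ∈ u ∷ v ∷ ps ⊎ w ∈ ss
    split′ 0th = inj₁ 0th
    split′ {w} (there w∈) with w ≟ v
    ... | yes refl = inj₁ 1st
    ... | no w≢v with split (∈-filter⁺ (λ w → ¬? (w ≟ v)) w∈ w≢v)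
    ... | inj₁ p = inj₁ (there (there p))
    ... | inj₂ p = inj₂ p
  ... | no ∄ = record
    { r = r ; q = suc q
    ; pairs = pairs
    ; points = embeds-∪ (λ { 0th w∈ → separate (ss⊆ w∈) }) point points
    ; split = λ { 0th → inj₂ 0th ; (there w∈) → [ inj₁ , inj₂ ∘ there ]′ (split w∈) }
    ; ps⊆ = there ∘ ps⊆
    ; ss⊆ = λ { 0th → 0th ; (there p) → there (ss⊆ p) }
    ; apart = λ
        { p 0th → case separate (ps⊆ p) of λ (u≢ , uw , wu) → ≢-sym u≢ , wu , uw
        ; p (there q) → apart p q }
    }
    where
    open PairsAndPoints (decompose fuel xs len xs! (once ∘ there))

    point : Embeds H K₁ (u ∷ [])
    point = embeds-lookup ([] ∷ []) λ { A A → off (λ e → irrefl e refl) }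

    separate : ∀ {w} → w ∈ xs → u ≢ w × H u w ≡ false × H w u ≡ false
    separate w∈ = All.lookup u∉ w∈ , non-adjacent λ uw → ∄ (_ , w∈ , uw)

  -- Being closed under adjacency, `vs` is a union of components of H; what remains has degree at
  -- most one and is left to `decompose`.
  assemble : ∀ {vs} {K : Graph (length vs)} → Unique vs →
    (∀ i j → H (lookup vs i) (lookup vs j) ≡ K i j) →
    (∀ {u v} → u ∈ vs → u ~ v → v ∈ vs) →
    (∀ {u} → u ∉ vs → ¬ Branch H u) →
    ∃[ r ] ∃[ q ] (H ≅ (K ∪ (copies r (P 2) ∪ copies q K₁)))
  assemble {vs} vs! faithful closed unbranched-outside = r , q , embeds-≅ everything
    (embeds-∪ core-apart (embeds-lookup vs! faithful) (embeds-∪ apart pairs points))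
    where
    outer = outsideOf vs

    outer⁻ : ∀ {v} → v ∈ outer → v ∉ vs
    outer⁻ = proj₂ ∘ ∈-filter⁻ (λ v → ¬? (v ∈? vs)) {xs = allFin n}

    open PairsAndPoints (decompose (length outer) outer ≤-refl (Unique.filter⁺ _ (Unique.allFin⁺ n))
      (λ u∈ → unbranched (unbranched-outside (outer⁻ u∈))))

    core-apart : ∀ {u v} → u ∈ vs → v ∈ ps ++ ss → u ≢ v × H u v ≡ false × H v u ≡ false
    core-apart u∈ v∈ = (λ { refl → v∉ u∈ }) , non-adjacent (v∉ ∘ closed u∈)
      where v∉ = outer⁻ ([ ps⊆ , ss⊆ ]′ (∈-++⁻ ps v∈))

    everything : ∀ v → v ∈ vs ++ (ps ++ ss)
    everything v with v ∈? vs
    ... | yes p = ∈-++⁺ˡ p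
    ... | no ¬p = ∈-++⁺ʳ vs ([ ∈-++⁺ˡ , ∈-++⁺ʳ ps ]′
      (split (∈-filter⁺ (λ v → ¬? (v ∈? vs)) (∈-allFin v) ¬p)))

  data Shape : Set where
    matching : ∀ r q → 2 ≤ r → H ≅ (copies r (P 2) ∪ copies q K₁) → Shape
    path₄    : ∃[ r ] ∃[ q ] (H ≅ (P 4 ∪ (copies r (P 2) ∪ copies q K₁))) → Shape
    path₃    : ∃[ r ] ∃[ q ] (H ≅ (P 3 ∪ (copies r (P 2) ∪ copies q K₁))) → Shape
    triangle : ∃[ r ] ∃[ q ] (H ≅ (C₃ ∪ (copies r (P 2) ∪ copies q K₁))) → Shape

  module _ (sparse : Sparse H) where

    open Sparse sparse

    private
      diagonal : ∀ {u} → H u u ≡ false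
      diagonal = off λ e → irrefl e refl

      one-of : ∀ {u x y} → x ≢ y → u ~ x → u ~ y → ∀ {v} → u ~ v → v ≡ x ⊎ v ≡ y
      one-of {x = x} {y} x≢y ux uy {v} uv with v ≟ x | v ≟ y
      ... | yes p | _     = inj₁ p
      ... | no _  | yes p = inj₂ p
      ... | no ¬p | no ¬q = ⊥-elim (degree≤2 ux uy uv x≢y (≢-sym ¬p) (≢-sym ¬q))

      -- Branches are pairwise adjacent, so a closed set that contains one branch contains them all.
      outside-core : ∀ {vs b} → b ∈ vs → Branch H b → (∀ {u v} → u ∈ vs → u ~ v → v ∈ vs) →
                     ∀ {u} → u ∉ vs → ¬ Branch H u
      outside-core b∈ bb closed u∉ bu =
        u∉ (closed b∈ (branches-adjacent (λ { refl → u∉ b∈ }) bb bu))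

      -- On the path z - x - u - y the inner vertices are branches. If z were one, it would be
      -- adjacent to u, whose neighbours are x and y; if y were one, it would be adjacent to x. So
      -- both ends are leaves and the path is a component.
      path₄-shape : ∀ {z x u y} → u ~ x → u ~ y → x ≢ y → ¬ x ~ y → x ~ z → z ≢ u → Shape
      path₄-shape {z} {x} {u} {y} ux uy x≢y ¬xy xz z≢u = path₄
        (assemble {K = P 4} distinct faithful closed (outside-core 2nd branch-u closed))
        where
        branch-u : Branch H u
        branch-u = x , y , x≢y , ux , uy

        branch-x : Branch H x
        branch-x = u , z , ≢-sym z≢u , symm ux , xz

        z≢y : z ≢ y
        z≢y refl = ¬xy xz

        ¬uz : ¬ u ~ z
        ¬uz uz = [ irrefl xz ∘ sym , z≢y ]′ (one-of x≢y ux uy uz)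

        unbranched-z : ¬ Branch H z
        unbranched-z bz = ¬uz (branches-adjacent (≢-sym z≢u) branch-u bz)

        unbranched-y : ¬ Branch H y
        unbranched-y by = ¬xy (branches-adjacent x≢y branch-x by)

        ¬zy : ¬ z ~ y
        ¬zy zy = unbranched-z (x , y , x≢y , symm xz , zy)

        distinct : Unique (z ∷ x ∷ u ∷ y ∷ [])
        distinct = (≢-sym (irrefl xz) ∷ z≢u ∷ z≢y ∷ []) ∷ (≢-sym (irrefl ux) ∷ x≢y ∷ []) ∷ (irrefl uy ∷ []) ∷ [] ∷ []

        faithful : ∀ i j → H (lookup (z ∷ x ∷ u ∷ y ∷ []) i) (lookup (z ∷ x ∷ u ∷ y ∷ []) j) ≡ P 4 i j
        faithful A A = diagonal
        faithful A B = symm xz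
        faithful A C = off (¬uz ∘ symm)
        faithful A X = off ¬zy
        faithful B A = xz
        faithful B B = diagonal
        faithful B C = symm ux
        faithful B X = off ¬xy
        faithful C A = off ¬uz
        faithful C B = ux
        faithful C C = diagonal
        faithful C X = uy
        faithful X A = off (¬zy ∘ symm)
        faithful X B = off (¬xy ∘ symm)
        faithful X C = symm uy
        faithful X X = diagonal

        closed : ∀ {s v} → s ∈ z ∷ x ∷ u ∷ y ∷ [] → s ~ v → v ∈ z ∷ x ∷ u ∷ y ∷ []
        closed 0th e = there (here (unbranched unbranched-z e (symm xz)))
        closed 1st e with one-of (≢-sym z≢u) (symm ux) xz e
        ... | inj₁ p = there (there (here p))
        ... | inj₂ p = here p
        closed 2nd e with one-of x≢y ux uy e
        ... | inj₁ p = there (here p)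
        ... | inj₂ p = there (there (there (here p)))
        closed 3rd e = there (there (here (unbranched unbranched-y e (symm uy))))

      triangle-shape : ∀ {u x y} → u ~ x → u ~ y → x ≢ y → x ~ y → Shape
      triangle-shape {u} {x} {y} ux uy x≢y xy = triangle
        (assemble {K = C₃} distinct faithful closed (outside-core 0th (x , y , x≢y , ux , uy) closed))
        where
        distinct : Unique (u ∷ x ∷ y ∷ [])
        distinct = (irrefl ux ∷ irrefl uy ∷ []) ∷ (x≢y ∷ []) ∷ [] ∷ []

        faithful : ∀ i j → H (lookup (u ∷ x ∷ y ∷ []) i) (lookup (u ∷ x ∷ y ∷ []) j) ≡ C₃ i j
        faithful A A = diagonal
        faithful A B = ux
        faithful A C = uy
        faithful B A = symm ux
        faithful B B = diagonal
        faithful B C = xy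
        faithful C A = symm uy
        faithful C B = symm xy
        faithful C C = diagonal

        closed : ∀ {s v} → s ∈ u ∷ x ∷ y ∷ [] → s ~ v → v ∈ u ∷ x ∷ y ∷ []
        closed 0th e with one-of x≢y ux uy e
        ... | inj₁ p = there (here p)
        ... | inj₂ p = there (there (here p))
        closed 1st e with one-of (irrefl uy) (symm ux) xy e
        ... | inj₁ p = here p
        ... | inj₂ p = there (there (here p))
        closed 2nd e with one-of (irrefl ux) (symm uy) (symm xy) e
        ... | inj₁ p = here p
        ... | inj₂ p = there (here p)

      path₃-shape : ∀ {u x y} → u ~ x → u ~ y → x ≢ y → ¬ x ~ y →
                    (∀ {v} → x ~ v → v ≡ u) → (∀ {v} → y ~ v → v ≡ u) → Shape
      path₃-shape {u} {x} {y} ux uy x≢y ¬xy only-x only-y = path₃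
        (assemble {K = P 3} distinct faithful closed (outside-core 1st (x , y , x≢y , ux , uy) closed))
        where
        distinct : Unique (x ∷ u ∷ y ∷ [])
        distinct = (≢-sym (irrefl ux) ∷ x≢y ∷ []) ∷ (irrefl uy ∷ []) ∷ [] ∷ []

        faithful : ∀ i j → H (lookup (x ∷ u ∷ y ∷ []) i) (lookup (x ∷ u ∷ y ∷ []) j) ≡ P 3 i j
        faithful A A = diagonal
        faithful A B = symm ux
        faithful A C = off ¬xy
        faithful B A = ux
        faithful B B = diagonal
        faithful B C = uy
        faithful C A = off (¬xy ∘ symm)
        faithful C B = symm uy
        faithful C C = diagonal

        closed : ∀ {s v} → s ∈ x ∷ u ∷ y ∷ [] → s ~ v → v ∈ x ∷ u ∷ y ∷ []
        closed 0th e = there (here (only-x e))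
        closed 1st e with one-of x≢y ux uy e
        ... | inj₁ p = here p
        ... | inj₂ p = there (there (here p))
        closed 2nd e = there (here (only-y e))

      -- A further neighbour of x settles the shape without a look at y, because `path₄-shape`
      -- itself excludes a further neighbour there.
      branch-shape : ∀ {u} → Branch H u → Shape
      branch-shape {u} (x , y , x≢y , ux , uy) with x ~? y
      ... | yes xy = triangle-shape ux uy x≢y xy
      ... | no ¬xy with any? (λ z → (x ~? z) ×-dec ¬? (z ≟ u)) | any? (λ z → (y ~? z) ×-dec ¬? (z ≟ u))
      ... | yes (z , xz , z≢u) | _ = path₄-shape ux uy x≢y ¬xy xz z≢u
      ... | no _ | yes (z , yz , z≢u) = path₄-shape uy ux (≢-sym x≢y) (¬xy ∘ symm) yz z≢u
      ... | no ∄x | no ∄y = path₃-shape ux uy x≢y ¬xy (only ∄x) (only ∄y)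
        where
        only : ∀ {s} → ¬ (∃[ z ] (s ~ z × z ≢ u)) → ∀ {v} → s ~ v → v ≡ u
        only ∄ {v} e with v ≟ u
        ... | yes p = p
        ... | no ¬p = contradiction (v , e , ¬p) ∄

      -- Two edges supply three distinct vertices u, v, w of positive degree, but one pair has room
      -- for only two.
      two-pairs : ∀ r q → H ≅ (copies r (P 2) ∪ copies q K₁) → TwoEdges H → 2 ≤ r
      two-pairs zero q (f , H≡K) (u , v , _ , _ , uv , _) with ∪-edge (copies 0 (P 2)) (copies q K₁) (trans (sym (H≡K u v)) uv)
      ... | inj₂ (_ , _ , _ , _ , e) = contradiction e (copies-K₁-empty q)
      two-pairs (suc zero) q (f , H≡K) (u , v , w , z , uv , wz , w≢u , w≢v) =
        three-in-two i j k (irrefl uv ∘ same pᵢ pⱼ) (w≢u ∘ same pₖ pᵢ) (w≢v ∘ same pₖ pⱼ)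
        where
        open Inverse f using (to; from; strictlyInverseʳ)

        position : Fin 2 → Fin (1 * 2 + q * 1)
        position i = (i ↑ˡ 0) ↑ˡ (q * 1)

        ends : ∀ {u v} → u ~ v → (∃[ i ] to u ≡ position i) × (∃[ j ] to v ≡ position j)
        ends {u} {v} e with ∪-edge (copies 1 (P 2)) (copies q K₁) (trans (sym (H≡K u v)) e)
        ... | inj₂ (_ , _ , _ , _ , e′) = contradiction e′ (copies-K₁-empty q)
        ... | inj₁ (x , y , p , p′ , e′) with ∪-edge (P 2) (copies 0 (P 2)) {x} {y} e′
        ... | inj₁ (i , j , refl , refl , _) = (i , p) , (j , p′)

        i = proj₁ (proj₁ (ends uv))
        pᵢ = proj₂ (proj₁ (ends uv))
        j = proj₁ (proj₂ (ends uv))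
        pⱼ = proj₂ (proj₂ (ends uv))
        k = proj₁ (proj₁ (ends wz))
        pₖ = proj₂ (proj₁ (ends wz))

        same : ∀ {u v i j} → to u ≡ position i → to v ≡ position j → i ≡ j → u ≡ v
        same p p′ refl = trans (sym (strictlyInverseʳ _)) (trans (cong from (trans p (sym p′))) (strictlyInverseʳ _))

        three-in-two : ∀ (i j k : Fin 2) → i ≢ j → k ≢ i → k ≢ j → 2 ≤ 1
        three-in-two A A _ i≢j _ _ = contradiction refl i≢j
        three-in-two B B _ i≢j _ _ = contradiction refl i≢j
        three-in-two A B A _ k≢i _ = contradiction refl k≢i
        three-in-two A B B _ _ k≢j = contradiction refl k≢j
        three-in-two B A B _ k≢i _ = contradiction refl k≢i
        three-in-two B A A _ _ k≢j = contradiction refl k≢j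
      two-pairs (suc (suc r)) _ _ _ = s≤s (s≤s z≤n)

    classify : TwoEdges H → Shape
    classify two with any? branch?
    ... | yes (_ , b) = branch-shape b
    -- The core is empty: `splitAt 0` always answers `inj₂`, so the union with the empty graph
    -- computes to its right part.
    ... | no ∄ with assemble {K = λ ()} [] (λ ()) (λ ()) (λ _ b → ∄ (_ , b))
    ... | r , q , iso = matching r q (two-pairs r q iso two) iso

-- Parameters of the listed graphs

-- An isomorphism forces the orders to agree, and this one equation yields both the bound on the
-- number of pairs and the number of isolated vertices.
pairs-count : ∀ {n} d r q → n ≡ d + (r * 2 + q * 1) → r ≤ (n ∸ d) / 2 × q ≡ n ∸ 2 * r ∸ d
pairs-count {n} d r q size = bound , sym points
  where
  remaining : n ∸ d ≡ r * 2 + q * 1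
  remaining = trans (cong (_∸ d) size) (m+n∸m≡n d _)

  bound : r ≤ (n ∸ d) / 2
  bound = subst (_≤ (n ∸ d) / 2) (m*n/n≡m r 2)
    (/-monoˡ-≤ 2 (subst (r * 2 ≤_) (sym remaining) (m≤m+n (r * 2) (q * 1))))

  open ≡-Reasoning

  points : n ∸ 2 * r ∸ d ≡ q
  points = begin
    n ∸ 2 * r ∸ d           ≡⟨ ∸-+-assoc n (2 * r) d ⟩
    n ∸ (2 * r + d)         ≡⟨ cong (n ∸_) (+-comm (2 * r) d) ⟩
    n ∸ (d + 2 * r)         ≡⟨ ∸-+-assoc n d (2 * r) ⟨
    n ∸ d ∸ 2 * r           ≡⟨ cong₂ _∸_ remaining (*-comm 2 r) ⟩
    r * 2 + q * 1 ∸ r * 2   ≡⟨ m+n∸m≡n (r * 2) (q * 1) ⟩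
    q * 1                   ≡⟨ *-identityʳ q ⟩
    q                       ∎

Listed : (n : ℕ) → Graph n → Set
Listed n H =
    (∃[ r ] (2 ≤ r × r ≤ n / 2 × (H ≅ (copies r (P 2) ∪ copies (n ∸ 2 * r) K₁))))
  ⊎ (∃[ s ] (s ≤ (n ∸ 4) / 2 × (H ≅ (P 4 ∪ (copies s (P 2) ∪ copies (n ∸ 2 * s ∸ 4) K₁)))))
  ⊎ (∃[ t ] (t ≤ (n ∸ 3) / 2 × (H ≅ (P 3 ∪ (copies t (P 2) ∪ copies (n ∸ 2 * t ∸ 3) K₁)))))
  ⊎ (∃[ t ] (t ≤ (n ∸ 3) / 2 × (H ≅ (C₃ ∪ (copies t (P 2) ∪ copies (n ∸ 2 * t ∸ 3) K₁)))))

resize : ∀ {n d} {H : Graph n} (K : Graph d) → ∃[ r ] ∃[ q ] (H ≅ (K ∪ (copies r (P 2) ∪ copies q K₁))) →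
         ∃[ r ] (r ≤ (n ∸ d) / 2 × (H ≅ (K ∪ (copies r (P 2) ∪ copies (n ∸ 2 * r ∸ d) K₁))))
resize {d = d} {H} K (r , q , iso) with pairs-count d r q (↔⇒≡ (proj₁ iso))
... | bound , q≡ = r , bound , subst (λ q → H ≅ (K ∪ (copies r (P 2) ∪ copies q K₁))) q≡ iso

sparse⇒listed : ∀ {n} {H : Graph n} → (∀ {u v} → H u v ≡ true → u ≢ v) → (∀ {u v} → H u v ≡ true → H v u ≡ true) →
                Sparse H → TwoEdges H → Listed n H
sparse⇒listed {H = H} irrefl symm sparse two with Classify.classify irrefl symm sparse two
... | Classify.path₄ s    = inj₂ (inj₁ (resize (P 4) s))
... | Classify.path₃ s    = inj₂ (inj₂ (inj₁ (resize (P 3) s)))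
... | Classify.triangle s = inj₂ (inj₂ (inj₂ (resize C₃ s)))
-- There is no core, so d = 0 and the subtractions of d compute away.
... | Classify.matching r q 2≤r iso with pairs-count 0 r q (↔⇒≡ (proj₁ iso))
... | bound , q≡ = inj₁ (r , 2≤r , bound , subst (λ q → H ≅ (copies r (P 2) ∪ copies q K₁)) q≡ iso)

core-sparse : ∀ {n d} {H : Graph n} {K : Graph d} r q → Sparse K → TwoEdges K →
              H ≅ (K ∪ (copies r (P 2) ∪ copies q K₁)) → Sparse H × TwoEdges H
core-sparse {K = K} r q sK tK iso =
    sparse-≅ iso (∪-sparse sK (λ {u} {v} {w} → pairs-matching r q {u} {v} {w}))
  , twoEdges-≅ iso (∪-twoEdgesˡ {G = K} tK)

listed⇒sparse : ∀ {n} {H : Graph n} → Listed n H → Sparse H × TwoEdges H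
listed⇒sparse {n} (inj₁ (r , 2≤r , _ , iso)) =
    sparse-≅ iso (matching-sparse (λ {u} {v} {w} → pairs-matching r (n ∸ 2 * r) {u} {v} {w}))
  , twoEdges-≅ iso (pairs-twoEdges r (n ∸ 2 * r) 2≤r)
listed⇒sparse {n} (inj₂ (inj₁ (s , _ , iso)))        = core-sparse s (n ∸ 2 * s ∸ 4) P₄-sparse P₄-twoEdges iso
listed⇒sparse {n} (inj₂ (inj₂ (inj₁ (t , _ , iso)))) = core-sparse t (n ∸ 2 * t ∸ 3) P₃-sparse P₃-twoEdges iso
listed⇒sparse {n} (inj₂ (inj₂ (inj₂ (t , _ , iso)))) = core-sparse t (n ∸ 2 * t ∸ 3) C₃-sparse C₃-twoEdges iso

λ₃⇔listed : ∀ {k} {G H : Graph (3 + k)} → IsSimple G → IsComplement G H → Connected G →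
            LambdaK G 3 k ⇔ Listed (3 + k) H
λ₃⇔listed simple isComplement connected = mk⇔
  (λ l → uncurry (sparse⇒listed ~⇒≢ ~-sym) (λ₃⇒sparse connected l))
  (λ l → uncurry (sparse⇒λ₃ connected) (listed⇒sparse l))
  where
  open IsComplement isComplement
  open Packings simple isComplement

theorem2 : ∀ (n : ℕ) (G : Graph n) → IsSimple G → 3 ≤ n → Connected G →
    LambdaK G 3 (n ∸ 3) ⇔
    ((∃[ r ] (2 ≤ r × r ≤ n / 2 × (complement G ≅ (copies r (P 2) ∪ copies (n ∸ 2 * r) K₁))))
    ⊎ (∃[ s ] (s ≤ (n ∸ 4) / 2 × (complement G ≅ (P 4 ∪ (copies s (P 2) ∪ copies (n ∸ 2 * s ∸ 4) K₁)))))
    ⊎ (∃[ t ] (t ≤ (n ∸ 3) / 2 × (complement G ≅ (P 3 ∪ (copies t (P 2) ∪ copies (n ∸ 2 * t ∸ 3) K₁)))))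
    ⊎ (∃[ t ] (t ≤ (n ∸ 3) / 2 × (complement G ≅ (C₃ ∪ (copies t (P 2) ∪ copies (n ∸ 2 * t ∸ 3) K₁))))))
-- Matching on the bound turns n into 3 + k, and `n ∸ 3` computes to k.
theorem2 _ G simple (s≤s (s≤s (s≤s z≤n))) connected =
  λ₃⇔listed simple (complement-isComplement simple) connected
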